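{- Let $(G,l,A,\sigma)$ be a labelled graph with multiplicity on $n$ vertices and let $1,k$ be two distinct vertices of $G$ with $\{1,k\}\notin E_G$. Suppose the collapse of $1$ and $k$ is singular. Then there are a (nonempty) finite number of matrices $C_{1\equiv k}$ such that $$(R_{l'}\,\mathcal{A}_G)\,C_{1\equiv k}=\mathcal{A}_{G_{1\equiv k}},$$ where $l'$ is the labeling of $G$ obtained from $l$ by giving the same label to the two edges of each collapsing pair, $R_{l'}$ is the corresponding relabeling matrix (so that $R_{l'}\mathcal{A}_{(G,l,A,\sigma)}=\mathcal{A}_{(G,l',A',\sigma)}$), and $C_{1\equiv k}$ is a matrix of the collapse, i.e. when the columns of $\mathcal{A}_G$ are ordered with those of the feasible variables first, $C_{1\equiv k}$ is the $2^{n-1}\times2^{n-2}$ matrix $\begin{pmatrix}\operatorname{id}\\0\end{pmatrix}$.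
   Context: Graphs are finite and simple, $G=(V_G;E_G)$ with $|V_G|=n$. Partitions. For a finite nonempty set $V$, $\Pi_V$ is the set of unordered pairs $A|B$ with $A\cup B=V$, $A\cap B=\emptyset$ (one of $A,B$ may be empty; $A|B=B|A$). $Cut_G(A|B)$ is the set of edges of $G$ with one endpoint in $A$ and the other in $B$. Labelled graphs with multiplicity. A labeling is a surjective map $l:E_G\to A$ onto a set $A$ of labels. A multiplicity map is a map $\sigma:E_G\to\mathbb{Z}\setminus\{0\}$. Then $(G,l,A,\sigma)$ is a labelled graph with multiplicity. The matrix $\mathcal{A}$. The toric map $\phi_{(G,l,A,\sigma)}$ sends the variable $r_p$ ($p\in\Pi_{V_G}$) to $\prod_{e\in Cut_G(p)}s_{l(e)}^{\sigma(e)}\prod_{e\in E_G\setminus Cut_G(p)}t_{l(e)}^{\sigma(e)}$ in variables $s_a,t_a$ ($a\in A$). $\mathcal{A}_G=\mathcal{A}_{(G,l,A,\sigma)}$ is the integer matrix with rows indexed first by $s_a$, then by $t_a$ ($a\in A$), and columns indexed by $\Pi_{V_G}$ (in some chosen order), the column of $p$ being the exponent vector of the image of $r_p$. Collapse. Let $\{1,k\}\notin E_G$. The collapsed graph $(G_{1\equiv k},l',A',\sigma')$ has vertex set $V_G\setminus\{k\}$; its edge set $E'$ is obtained from $E_G$ by replacing each edge $\{i,k\}$ by $\{i,1\}$, keeping only one copy of repeated edges. A collapsing pair is a pair of edges $\{1,i\},\{k,i\}$ both in $E_G$. The collapse is singular if $|E'|<|E_G|$, i.e. there is at least one collapsing pair.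 For $\{i,j\}\in E'$ with $1\notin\{i,j\}$, $\sigma'(\{i,j\})=\sigma(\{i,j\})$; for $\{1,j\}\in E'$, $\sigma'(\{1,j\})=\sigma(\{1,j\})+\sigma(\{k,j\})$, where $\sigma$ of a non-edge is read as $0$; $\sigma'$ is assumed to take nonzero values. The label set $A'$ is the quotient of $A$ by the equivalence relation generated by $l(\{k,i\})\sim l(\{1,i\})$ for all collapsing pairs; the relabeling $l'$ of $G$ sends an edge to the class of its $l$-label, and the labeling $l'$ of $G_{1\equiv k}$ sends an edge of $E'$ to the $l'$-label of any edge of $G$ from which it comes. $\mathcal{A}_{G_{1\equiv k}}$ is the matrix of $(G_{1\equiv k},l',A',\sigma')$. Relabeling matrix. $R_{l'}=\begin{pmatrix}B_{l'}&0\\0&B_{l'}\end{pmatrix}$, where $B_{l'}$ is the $|A'|\times|A|$ matrix with entry $1$ in position $(a',a)$ if $a'$ is the class of $a$, and $0$ otherwise. Feasibility. A partition $A|B\in\Pi_{V_G}$ is feasible if $1$ and $k$ lie both in $A$ or both in $B$; the variable $r_{A|B}$ is then feasible, otherwise non-feasible. For $p\in\Pi_{V_G\setminus\{k\}}$, $p_f\in\Pi_{V_G}$ is the feasible partition obtained by adding $k$ to the part of $p$ containing $1$. In the block form of $C_{1\equiv k}$, the feasible columns are ordered so that $p_f$ is in the position of $p$ in the chosen order of the columns of $\mathcal{A}_{G_{1\equiv k}}$. -}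

module Defs where

open import Data.Bool.Base using (if_then_else_)
open import Data.Fin.Base using (Fin; zero; suc; punchIn; punchOut; _↑ˡ_; _↑ʳ_)
open import Data.Fin.Properties using (_≟_; _<?_; any?; punchOut-injective; punchOut-cong; punchOut-punchIn; punchInᵢ≢i)
open import Data.Fin.Subset using (Subset; Side; _∈_; _∪_; _∩_; ⊤; ⊥)
open import Data.Fin.Subset.Properties using (_∈?_)
open import Data.Integer.Base using (ℤ; 0ℤ; 1ℤ; _+_; _*_)
open import Data.Integer.Properties using (+-*-semiring)
open import Data.List.Base using (List; []; _∷_; length; filter; allFin; cartesianProduct)
open import Data.List.Membership.Propositional using () renaming (_∈_ to _∈ˡ_)
open import Data.List.Membership.Propositional.Properties using (∈-filter⁺; ∈-filter⁻; ∈-cartesianProduct⁺; ∈-allFin)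
open import Data.List.Relation.Unary.All using (All)
open import Data.List.Relation.Unary.Any using (Any; here; there)
open import Data.Nat.Base as ℕ using (ℕ; zero; suc; _^_)
open import Data.Product.Base using (Σ; ∃; ∃₂; _×_; _,_; proj₁; proj₂)
open import Data.Sum.Base using (_⊎_; inj₁; inj₂)
open import Data.Vec.Base using (_∷_; lookup; insertAt; zipWith; replicate)
open import Data.Vec.Functional using (Vector; _++_)
open import Data.Vec.Properties using (lookup-zipWith; lookup-replicate)
open import Function.Base using (_∘_; id)
open import Function.Bundles using (Bijection; _⇔_; mk⇔; Equivalence)
open import Function.Definitions using (StrictlySurjective)
open import Level using (0ℓ)
open import Relation.Binary.Bundles using (Setoid)
open import Relation.Binary.Core using (Rel; _⇒_)
open import Relation.Binary.Definitions using (Decidable; Symmetric)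
open import Relation.Binary.Construct.Closure.Equivalence as EqC using (EqClosure)
open import Relation.Binary.Construct.Closure.ReflexiveTransitive using (ε; _◅_)
open import Relation.Binary.Construct.Closure.Symmetric using (fwd; bwd)
open import Relation.Binary.PropositionalEquality using (_≡_; _≢_; refl; sym; trans; cong; cong₂; ≢-sym; setoid)
open import Relation.Nullary.Decidable using (Dec; yes; no; does; _×-dec_; _⊎-dec_; ¬?; map′)
open import Relation.Nullary.Negation using (¬_; contradiction)

open import Algebra.Properties.Semiring.Sum +-*-semiring using (sum)

Matrix : ℕ → ℕ → Set
Matrix m n = Fin m → Fin n → ℤ

infix  4 _≋_
infixl 7 _⊗_

_≋_ : ∀ {m n} → Matrix m n → Matrix m n → Set
M ≋ N = ∀ i j → M i j ≡ N i j

_⊗_ : ∀ {m n o} → Matrix m n → Matrix n o → Matrix m o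
(M ⊗ N) i j = sum λ k → M i k * N k j

𝟘 : ∀ {m n} → Matrix m n
𝟘 _ _ = 0ℤ

𝟙 : ∀ {n} → Matrix n n
𝟙 i j = if does (i ≟ j) then 1ℤ else 0ℤ

above : ∀ {m n o} → Matrix m o → Matrix n o → Matrix (m ℕ.+ n) o
above M N = M ++ N

beside : ∀ {m n o} → Matrix m n → Matrix m o → Matrix m (n ℕ.+ o)
beside M N i = M i ++ N i

-- A set of matrices is given up to entrywise equality: it is finite if a list
-- of members meets every member.
NonemptyFinite : ∀ {m n} → (Matrix m n → Set) → Set
NonemptyFinite P =
  ∃ P × ∃ λ Cs → All P Cs × (∀ C → P C → Any (C ≋_) Cs)

record Partition (n : ℕ) : Set where
  constructor _∣_⟨_,_⟩
  field
    A B      : Subset n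
    cover    : A ∪ B ≡ ⊤
    disjoint : A ∩ B ≡ ⊥

infix 4 _≈ₚ_
_≈ₚ_ : ∀ {n} → Rel (Partition n) 0ℓ
p ≈ₚ q = (A p ≡ A q × B p ≡ B q) ⊎ (A p ≡ B q × B p ≡ A q)
  where open Partition

Π : ℕ → Setoid 0ℓ 0ℓ
Π n = record
  { Carrier       = Partition n
  ; _≈_           = _≈ₚ_
  ; isEquivalence = record
    { refl  = inj₁ (refl , refl)
    ; sym   = λ where
        (inj₁ (a , b)) → inj₁ (sym a , sym b)
        (inj₂ (a , b)) → inj₂ (sym b , sym a)
    ; trans = λ where
        (inj₁ (a , b)) (inj₁ (c , d)) → inj₁ (trans a c , trans b d)
        (inj₁ (a , b)) (inj₂ (c , d)) → inj₂ (trans a c , trans b d)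
        (inj₂ (a , b)) (inj₁ (c , d)) → inj₂ (trans a d , trans b c)
        (inj₂ (a , b)) (inj₂ (c , d)) → inj₁ (trans a d , trans b c)
    }
  }

-- An order of the 2ⁿ elements of Π on 1 + n vertices.
ColumnOrder : ℕ → Set
ColumnOrder n = Bijection (setoid (Fin (2 ^ n))) (Π (suc n))

column : ∀ {n} → ColumnOrder n → Fin (2 ^ n) → Partition (suc n)
column = Bijection.to

-- i and j lie in different parts of the partition.
Separates : ∀ {n} → Partition n → Fin n → Fin n → Set
Separates p i j = (i ∈ A × j ∈ B) ⊎ (i ∈ B × j ∈ A)
  where open Partition p

separates? : ∀ {n} (p : Partition n) → Decidable (Separates p)
separates? p i j = (i ∈? A ×-dec j ∈? B) ⊎-dec (i ∈? B ×-dec j ∈? A)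
  where open Partition p

record Graph (n : ℕ) : Set₁ where
  field
    Adj    : Rel (Fin n) 0ℓ
    adj?   : Decidable Adj
    symm   : Symmetric Adj
    irrefl : ∀ {i} → ¬ Adj i i

∣E∣ : ∀ {n} → Graph n → ℕ
∣E∣ {n} G =
  length (filter (λ (i , j) → (i <? j) ×-dec adj? i j)
                 (cartesianProduct (allFin n) (allFin n)))
  where open Graph G

-- Maps out of the edge set are maps on adjacent ordered pairs which depend
-- only on the underlying unordered pair (in particular, not on the proof of
-- adjacency).  The label set is Fin a.
record LabelledGraph (n a : ℕ) : Set₁ where
  field
    graph : Graph n

  open Graph graph public

  field
    l     : ∀ {i j} → Adj i j → Fin a
    l-sym : ∀ {i j} (e : Adj i j) (e′ : Adj j i) → l e ≡ l e′
    l-sur : ∀ x → ∃₂ λ i j → Σ (Adj i j) λ e → l e ≡ x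
    σ     : ∀ {i j} → Adj i j → ℤ
    σ-sym : ∀ {i j} (e : Adj i j) (e′ : Adj j i) → σ e ≡ σ e′
    σ≢0   : ∀ {i j} (e : Adj i j) → σ e ≢ 0ℤ

  l-irr : ∀ {i j} (e e′ : Adj i j) → l e ≡ l e′
  l-irr e e′ = trans (l-sym e (symm e)) (l-sym (symm e) e′)

  σ-irr : ∀ {i j} (e e′ : Adj i j) → σ e ≡ σ e′
  σ-irr e e′ = trans (σ-sym e (symm e)) (σ-sym (symm e) e′)

  -- σ extended by 0 to non-edges.
  σ₀ : Fin n → Fin n → ℤ
  σ₀ i j with adj? i j
  ... | yes e = σ e
  ... | no  _ = 0ℤ

  edge-term : (∀ {i j} → Adj i j → ℤ) → Fin n → Fin n → ℤ
  edge-term f i j with i <? j | adj? i j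
  ... | yes _ | yes e = f e
  ... | _     | _     = 0ℤ

  -- Sum over the edges {i , j}, each taken once, with i < j.
  ∑ₑ : (∀ {i j} → Adj i j → ℤ) → ℤ
  ∑ₑ f = sum λ i → sum λ j → edge-term f i j

  -- The image of r_p under the toric map is a Laurent monomial in the
  -- variables s_x, t_x; it is given by its exponents.
  exponent-s exponent-t : Partition n → Fin a → ℤ
  exponent-s p x = ∑ₑ λ {i} {j} e →
    if does (separates? p i j ×-dec (l e ≟ x)) then σ e else 0ℤ
  exponent-t p x = ∑ₑ λ {i} {j} e →
    if does (¬? (separates? p i j) ×-dec (l e ≟ x)) then σ e else 0ℤ

  toric : Partition n → Vector ℤ (a ℕ.+ a)
  toric p = exponent-s p ++ exponent-t p

𝒜 : ∀ {n a} → LabelledGraph (suc n) a → ColumnOrder n → Matrix (a ℕ.+ a) (2 ^ n)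
𝒜 G ord i j = LabelledGraph.toric G (column ord j) i

-- cls presents Fin a′ as the quotient of Fin a by the equivalence relation
-- generated by R.
record IsQuotient {a a′ : ℕ} (R : Rel (Fin a) 0ℓ) (cls : Fin a → Fin a′) : Set where
  field
    surjective : StrictlySurjective _≡_ cls
    kernel     : ∀ {x y} → cls x ≡ cls y ⇔ EqClosure R x y

relabelling-block : ∀ {a a′} → (Fin a → Fin a′) → Matrix a′ a
relabelling-block cls x′ x = if does (x′ ≟ cls x) then 1ℤ else 0ℤ

relabelling-matrix : ∀ {a a′} → (Fin a → Fin a′) → Matrix (a′ ℕ.+ a′) (a ℕ.+ a)
relabelling-matrix cls = above (beside Bl 𝟘) (beside 𝟘 Bl)
  where Bl = relabelling-block cls

relabel : ∀ {n a a′} (G : LabelledGraph n a) (cls : Fin a → Fin a′) →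
          StrictlySurjective _≡_ cls → LabelledGraph n a′
relabel G cls sur = record
  { graph = graph
  ; l     = cls ∘ l
  ; l-sym = λ e e′ → cong cls (l-sym e e′)
  ; l-sur = λ y → let (x , cx≡y) = sur y ; (i , j , e , le≡x) = l-sur x
                  in i , j , e , trans (cong cls le≡x) cx≡y
  ; σ     = σ
  ; σ-sym = σ-sym
  ; σ≢0   = σ≢0
  }
  where open LabelledGraph G

-- Fin n stands for Fin (suc n) without k, by punchIn k.  The map sends k to v
-- and is the identity elsewhere.
contract : ∀ {n} {v k : Fin (suc n)} → v ≢ k → Fin (suc n) → Fin n
contract {k = k} v≢k u with k ≟ u
... | yes _   = punchOut (≢-sym v≢k)
... | no  k≢u = punchOut k≢u

module _ {n} {v k : Fin (suc n)} (v≢k : v ≢ k) where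

  contract-punchIn : ∀ i → contract v≢k (punchIn k i) ≡ i
  contract-punchIn i with k ≟ punchIn k i
  ... | yes k≡ = contradiction (sym k≡) (punchInᵢ≢i k i)
  ... | no  _  = trans (punchOut-cong k refl) (punchOut-punchIn k)

  contract-identifies : contract v≢k v ≡ contract v≢k k
  contract-identifies with k ≟ v | k ≟ k
  ... | yes k≡v | _      = contradiction (sym k≡v) v≢k
  ... | no _    | yes _  = punchOut-cong k refl
  ... | no _    | no k≢k = contradiction refl k≢k

  contract-fibres : ∀ u w → contract v≢k u ≡ contract v≢k w →
                    u ≡ w ⊎ (u ≡ v × w ≡ k) ⊎ (u ≡ k × w ≡ v)
  contract-fibres u w eq with k ≟ u | k ≟ w
  ... | yes k≡u | yes k≡w = inj₁ (trans (sym k≡u) k≡w)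
  ... | yes k≡u | no  k≢w = inj₂ (inj₂ (sym k≡u , sym (punchOut-injective (≢-sym v≢k) k≢w eq)))
  ... | no  k≢u | yes k≡w = inj₂ (inj₁ (punchOut-injective k≢u (≢-sym v≢k) eq , sym k≡w))
  ... | no  k≢u | no  k≢w = inj₁ (punchOut-injective k≢u k≢w eq)

private
  quotient-list : ∀ {a} (ps : List (Fin a × Fin a)) →
    ∃ λ a′ → Σ (Fin a → Fin a′) λ cls → IsQuotient (λ x y → (x , y) ∈ˡ ps) cls
  quotient-list [] = _ , id , record
    { surjective = λ x → x , refl
    ; kernel     = mk⇔ (λ { refl → ε }) λ { ε → refl ; (fwd () ◅ _) ; (bwd () ◅ _) }
    }
  quotient-list {a} ((x , y) ∷ ps) with quotient-list ps
  ... | a′ , cls , q = go a′ cls q (cls x ≟ cls y)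
    where
    R R⁺ : Rel (Fin a) 0ℓ
    R  u w = (u , w) ∈ˡ ps
    R⁺ u w = (u , w) ∈ˡ ((x , y) ∷ ps)

    lift : EqClosure R ⇒ EqClosure R⁺
    lift = EqC.map there

    fold : ∀ {b} (f : Fin a → Fin b) → (∀ {u w} → R⁺ u w → f u ≡ f w) →
           ∀ {u w} → EqClosure R⁺ u w → f u ≡ f w
    fold f h ε           = refl
    fold f h (fwd r ◅ s) = trans (h r) (fold f h s)
    fold f h (bwd r ◅ s) = trans (sym (h r)) (fold f h s)

    go : ∀ a′ (cls : Fin a → Fin a′) → IsQuotient R cls → Dec (cls x ≡ cls y) →
         ∃ λ a″ → Σ (Fin a → Fin a″) λ cls″ → IsQuotient R⁺ cls″
    go a′ cls q (yes eq) = a′ , cls , record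
      { surjective = surjective
      ; kernel     = mk⇔ (lift ∘ Equivalence.to kernel) (fold cls resp)
      }
      where
      open IsQuotient q
      resp : ∀ {u w} → R⁺ u w → cls u ≡ cls w
      resp (here refl) = eq
      resp (there r)   = Equivalence.from kernel (fwd r ◅ ε)
    go zero     cls q (no _)   with () ← cls x
    go (suc a′) cls q (no neq) = a′ , cls″ , record
      { surjective = λ z → let (u , eq) = surjective (punchIn (cls y) z)
                           in u , trans (cong (contract neq) eq) (contract-punchIn neq z)
      ; kernel     = mk⇔ (λ eq → ker (contract-fibres neq _ _ eq)) (fold cls″ resp)
      }
      where
      open IsQuotient q
      cls″ = contract neq ∘ cls
      resp : ∀ {u w} → R⁺ u w → cls″ u ≡ cls″ w
      resp (here refl) = contract-identifies neq
      resp (there r)   = cong (contract neq) (Equivalence.from kernel (fwd r ◅ ε))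
      old : ∀ {u w} → cls u ≡ cls w → EqClosure R⁺ u w
      old = lift ∘ Equivalence.to kernel
      new : EqClosure R⁺ x y
      new = fwd (here refl) ◅ ε
      ker : ∀ {u w} → cls u ≡ cls w ⊎ (cls u ≡ cls x × cls w ≡ cls y) ⊎ (cls u ≡ cls y × cls w ≡ cls x) →
            EqClosure R⁺ u w
      ker (inj₁ eq)              = old eq
      ker (inj₂ (inj₁ (p , p′))) = EqC.transitive R⁺ (old p) (EqC.transitive R⁺ new (old (sym p′)))
      ker (inj₂ (inj₂ (p , p′))) = EqC.transitive R⁺ (old p) (EqC.transitive R⁺ (EqC.symmetric R⁺ new) (old (sym p′)))

quotient-exists : ∀ {a} {R : Rel (Fin a) 0ℓ} → Decidable R →
  ∃ λ a′ → Σ (Fin a → Fin a′) λ cls → IsQuotient R cls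
quotient-exists {a} {R} R? with quotient-list (filter (λ (x , y) → R? x y) (cartesianProduct (allFin a) (allFin a)))
... | a′ , cls , q = a′ , cls , record
  { surjective = surjective
  ; kernel     = mk⇔ (EqC.map (λ r → proj₂ (∈-filter⁻ R?′ {xs = pairs} r)) ∘ Equivalence.to kernel)
                     (Equivalence.from kernel ∘ EqC.map (λ {x} {y} r → ∈-filter⁺ R?′ (∈-cartesianProduct⁺ (∈-allFin x) (∈-allFin y)) r))
  }
  where
  open IsQuotient q
  R?′   = λ ((x , y) : Fin a × Fin a) → R? x y
  pairs = cartesianProduct (allFin a) (allFin a)

-- v₁ is the vertex written 1 in G_{1≡k}; x and y are the labels of {k , i}
-- and {v₁ , i} for a collapsing pair.
CollapsingLabels : ∀ {n a} → LabelledGraph n a → (v₁ k : Fin n) → Rel (Fin a) 0ℓ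
CollapsingLabels G v₁ k x y =
  ∃ λ i → Σ (Adj k i) λ e → Σ (Adj v₁ i) λ e′ → x ≡ l e × y ≡ l e′
  where open LabelledGraph G

collapsingLabels? : ∀ {n a} (G : LabelledGraph n a) (v₁ k : Fin n) →
                    Decidable (CollapsingLabels G v₁ k)
collapsingLabels? G v₁ k x y = any? λ i → dec i
  where
  open LabelledGraph G
  dec : ∀ i → Dec (Σ (Adj k i) λ e → Σ (Adj v₁ i) λ e′ → x ≡ l e × y ≡ l e′)
  dec i with adj? k i | adj? v₁ i
  ... | no ¬e | _      = no λ (e , _) → ¬e e
  ... | yes _ | no ¬e′ = no λ (_ , e′ , _) → ¬e′ e′
  ... | yes e | yes e′ =
    map′ (λ (p , p′) → e , e′ , p , p′)
         (λ (f , f′ , p , p′) → trans p (l-irr f e) , trans p′ (l-irr f′ e′))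
         ((x ≟ l e) ×-dec (y ≟ l e′))

module Collapse {n a : ℕ} (G : LabelledGraph (suc n) a) (v₁ k : Fin (suc n)) (v₁≢k : v₁ ≢ k) where

  open LabelledGraph G

  c : Fin (suc n) → Fin n
  c = contract v₁≢k

  v₁′ : Fin n
  v₁′ = punchOut (≢-sym v₁≢k)

  -- The edges of the collapsed graph are the images of the edges of G.
  Adj′ : Rel (Fin n) 0ℓ
  Adj′ i j = ∃₂ λ u w → Adj u w × c u ≡ i × c w ≡ j

  -- The multiplicity on the collapsed graph; it is meaningful on edges only.
  σ′ : Fin n → Fin n → ℤ
  σ′ i j with i ≟ v₁′ | j ≟ v₁′
  ... | yes _ | _     = σ₀ v₁ (punchIn k j) + σ₀ k (punchIn k j)
  ... | no _  | yes _ = σ₀ v₁ (punchIn k i) + σ₀ k (punchIn k i)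
  ... | no _  | no _  = σ₀ (punchIn k i) (punchIn k j)

  NonzeroMultiplicity : Set
  NonzeroMultiplicity = ∀ {i j} → Adj′ i j → σ′ i j ≢ 0ℤ

  σ₀-sym : ∀ i j → σ₀ i j ≡ σ₀ j i
  σ₀-sym i j with adj? i j | adj? j i
  ... | yes e | yes e′ = σ-sym e e′
  ... | yes e | no ¬e′ = contradiction (symm e) ¬e′
  ... | no ¬e | yes e′ = contradiction (symm e′) ¬e
  ... | no _  | no _   = refl

  σ′-sym : ∀ i j → σ′ i j ≡ σ′ j i
  σ′-sym i j with i ≟ v₁′ | j ≟ v₁′
  ... | yes refl | yes refl = refl
  ... | yes _    | no _     = refl
  ... | no _     | yes _    = refl
  ... | no _     | no _     = σ₀-sym (punchIn k i) (punchIn k j)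

  module _ (v₁≁k : ¬ Adj v₁ k) where

    collapsedGraph : Graph n
    collapsedGraph = record
      { Adj    = Adj′
      ; adj?   = λ i j → any? λ u → any? λ w → adj? u w ×-dec (c u ≟ i) ×-dec (c w ≟ j)
      ; symm   = λ (u , w , e , p , q) → w , u , symm e , q , p
      ; irrefl = λ (u , w , e , p , q) → irr e (contract-fibres v₁≢k u w (trans p (sym q)))
      }
      where
      irr : ∀ {u w} → Adj u w → ¬ (u ≡ w ⊎ (u ≡ v₁ × w ≡ k) ⊎ (u ≡ k × w ≡ v₁))
      irr e (inj₁ refl)                 = irrefl e
      irr e (inj₂ (inj₁ (refl , refl))) = v₁≁k e
      irr e (inj₂ (inj₂ (refl , refl))) = v₁≁k (symm e)

    Singular : Set
    Singular = ∣E∣ collapsedGraph ℕ.< ∣E∣ graph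

    module _ {a′ : ℕ} {cls : Fin a → Fin a′} (q : IsQuotient (CollapsingLabels G v₁ k) cls) where

      open IsQuotient q

      private
        pair : ∀ {i} (e : Adj k i) (e′ : Adj v₁ i) → cls (l e) ≡ cls (l e′)
        pair e e′ = Equivalence.from kernel (fwd (_ , e , e′ , refl , refl) ◅ ε)

        swap : ∀ {i j i′ j′} (e : Adj i j) (e′ : Adj i′ j′) →
               cls (l (symm e)) ≡ cls (l (symm e′)) → cls (l e) ≡ cls (l e′)
        swap e e′ eq = trans (cong cls (l-sym e _)) (trans eq (cong cls (l-sym _ e′)))

        Same : Rel (Fin (suc n)) 0ℓ
        Same u w = u ≡ w ⊎ (u ≡ v₁ × w ≡ k) ⊎ (u ≡ k × w ≡ v₁)

        same-label : ∀ {u w u′ w′} (e : Adj u w) (e′ : Adj u′ w′) →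
                     Same u u′ → Same w w′ → cls (l e) ≡ cls (l e′)
        same-label e e′ (inj₁ refl) (inj₁ refl) = cong cls (l-irr e e′)
        same-label e e′ (inj₂ (inj₁ (refl , refl))) (inj₁ refl) = sym (pair e′ e)
        same-label e e′ (inj₂ (inj₂ (refl , refl))) (inj₁ refl) = pair e e′
        same-label e e′ (inj₁ refl) (inj₂ (inj₁ (refl , refl))) = swap e e′ (sym (pair (symm e′) (symm e)))
        same-label e e′ (inj₁ refl) (inj₂ (inj₂ (refl , refl))) = swap e e′ (pair (symm e) (symm e′))
        same-label e e′ (inj₂ (inj₁ (refl , refl))) (inj₂ (inj₁ (refl , _))) = contradiction e irrefl
        same-label e e′ (inj₂ (inj₁ (refl , refl))) (inj₂ (inj₂ (refl , _))) = contradiction e v₁≁k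
        same-label e e′ (inj₂ (inj₂ (refl , refl))) (inj₂ (inj₁ (refl , _))) = contradiction (symm e) v₁≁k
        same-label e e′ (inj₂ (inj₂ (refl , refl))) (inj₂ (inj₂ (refl , _))) = contradiction e irrefl

      collapse : NonzeroMultiplicity → LabelledGraph n a′
      collapse nz = record
        { graph = collapsedGraph
        ; l     = λ (_ , _ , e , _) → cls (l e)
        ; l-sym = λ (u , w , e , p , q) (w′ , u′ , e′ , q′ , p′) →
            trans (same-label e (symm e′)
                    (contract-fibres v₁≢k u u′ (trans p (sym p′)))
                    (contract-fibres v₁≢k w w′ (trans q (sym q′))))
                  (cong cls (l-sym _ e′))
        ; l-sur = λ y → let (x , cx≡y) = surjective y ; (i , j , e , le≡x) = l-sur x
                        in c i , c j , (i , j , e , refl , refl) , trans (cong cls le≡x) cx≡y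
        ; σ     = λ {i} {j} _ → σ′ i j
        ; σ-sym = λ {i} {j} _ _ → σ′-sym i j
        ; σ≢0   = nz
        }

Feasible : ∀ {n} (v₁ k : Fin n) → Partition n → Set
Feasible v₁ k p = (v₁ ∈ A × k ∈ A) ⊎ (v₁ ∈ B × k ∈ B)
  where open Partition p

private
  zipWith-insertAt : ∀ {n} (f : Side → Side → Side) (xs ys : Subset n) k x y →
    zipWith f (insertAt xs k x) (insertAt ys k y) ≡ insertAt (zipWith f xs ys) k (f x y)
  zipWith-insertAt f xs       ys       zero    x y = refl
  zipWith-insertAt f (u ∷ xs) (w ∷ ys) (suc k) x y = cong (f u w ∷_) (zipWith-insertAt f xs ys k x y)

  insertAt-replicate : ∀ {n} (x : Side) (k : Fin (suc n)) → insertAt (replicate n x) k x ≡ replicate (suc n) x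
  insertAt-replicate         x zero    = refl
  insertAt-replicate {suc n} x (suc k) = cong (x ∷_) (insertAt-replicate x k)

  zipWith-extend : ∀ {n} (f : Side → Side → Side) (xs ys : Subset n) (k : Fin (suc n)) (v : Fin n) {x} →
    zipWith f xs ys ≡ replicate n x →
    zipWith f (insertAt xs k (lookup xs v)) (insertAt ys k (lookup ys v)) ≡ replicate (suc n) x
  zipWith-extend f xs ys k v {x} eq =
    trans (zipWith-insertAt f xs ys k _ _)
      (trans (cong₂ (λ zs z → insertAt zs k z) eq
               (trans (sym (lookup-zipWith f v xs ys)) (trans (cong (λ zs → lookup zs v) eq) (lookup-replicate v x))))
             (insertAt-replicate x k))

-- p_f: each part, viewed in Fin (suc n) by punchIn k, gets k iff it contains v₁.
feasible-extension : ∀ {n} {v₁ k : Fin (suc n)} → v₁ ≢ k → Partition n → Partition (suc n)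
feasible-extension {k = k} v₁≢k p = record
  { A        = insertAt A k (lookup A v)
  ; B        = insertAt B k (lookup B v)
  ; cover    = zipWith-extend _ A B k v cover
  ; disjoint = zipWith-extend _ A B k v disjoint
  }
  where
  open Partition p
  v = punchOut (≢-sym v₁≢k)

-- The first 2ᵐ partitions are feasible, in the order given by ord′, and the
-- others are not.  Note that 2 ^ suc m is definitionally 2 ^ m + (2 ^ m + 0).
record FeasibleFirst {m : ℕ} {v₁ k : Fin (suc (suc m))} (v₁≢k : v₁ ≢ k)
                     (ord′ : ColumnOrder m) (ord : ColumnOrder (suc m)) : Set where
  field
    feasible     : ∀ (i : Fin (2 ^ m)) → Feasible v₁ k (column ord (i ↑ˡ (2 ^ m ℕ.+ 0)))
    non-feasible : ∀ (i : Fin (2 ^ m ℕ.+ 0)) → ¬ Feasible v₁ k (column ord ((2 ^ m) ↑ʳ i))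
    aligned      : ∀ (j : Fin (2 ^ m)) → column ord (j ↑ˡ (2 ^ m ℕ.+ 0)) ≈ₚ feasible-extension v₁≢k (column ord′ j)

collapse-block : ∀ m → Matrix (2 ^ suc m) (2 ^ m)
collapse-block m = above {m = 2 ^ m} {n = 2 ^ m ℕ.+ 0} 𝟙 𝟘

-- The rows of C are indexed by the columns of 𝒜 G in the order ord, and its
-- columns by those of the collapsed graph in the order ord′; C becomes
-- (id over 0) when ord is rearranged into a feasible-first order.
IsCollapseMatrix : ∀ {m} {v₁ k : Fin (suc (suc m))} → v₁ ≢ k →
                   ColumnOrder (suc m) → ColumnOrder m → Matrix (2 ^ suc m) (2 ^ m) → Set
IsCollapseMatrix {m} v₁≢k ord ord′ C =
  ∃ λ ordᶠ → FeasibleFirst v₁≢k ord′ ordᶠ ×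
    (∀ r i → column ord r ≈ₚ column ordᶠ i → ∀ j → C r j ≡ collapse-block m i j)

{-# OPTIONS --safe #-}

-- For given column orders the matrix of the collapse is forced: its entry at
-- (r , j) is 1 if the r-th partition of V_G is the feasible extension p_f of
-- the j-th partition p of the collapsed graph, and 0 otherwise.  Multiplying
-- by it selects the columns of the feasible p_f, so the product formula says
-- that p_f and p have the same exponents for the relabelled and the collapsed
-- graph.  The edges of G lying over an edge of the collapsed graph have the
-- same l′-label, are cut by p_f exactly when their image is cut by p, and
-- their multiplicities add up to σ′.  A sum over edges is compared through
-- its double, the sum over all ordered pairs of vertices, so that contracting
-- k does not interfere with the condition i < j.  Finiteness over all column
-- orders holds because two orders differ by a permutation.
module Submission where

open import Defs
open import Data.Bool.Base using (Bool; true; false; not; _∧_; _∨_; _xor_; if_then_else_)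
open import Data.Bool.Properties using (not-involutive; not-distribʳ-xor; xor-assoc; xor-same; xor-identityʳ; ∧-zeroʳ) renaming (_≟_ to _≟ᵇ_)
open import Data.Fin.Base using (Fin; zero; suc; punchIn; punchOut; _↑ˡ_; _↑ʳ_; splitAt; combine; remQuot; finToFun; funToFin)
open import Data.Fin.Properties using (_≟_; _<?_; <-cmp; <-asym; all?; any?; splitAt⁻¹-↑ˡ; splitAt⁻¹-↑ʳ; remQuot-combine; combine-remQuot; combine-surjective; finToFun-funToFin; punchIn-punchOut; punchInᵢ≢i)
open import Data.Fin.Subset using (Subset; _∈_; ∁; _∪_; _∩_; ⊤; ⊥)
open import Data.Fin.Subset.Properties using (p∪∁p≡⊤)
open import Data.Integer.Base using (ℤ; 0ℤ; 1ℤ; _+_; _*_)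
open import Data.Integer.Properties using (+-*-semiring; +-identityˡ; +-identityʳ; +-assoc; +-comm; *-identityˡ; *-identityʳ; *-zeroˡ; *-zeroʳ; *-distribʳ-+; *-cancelˡ-≡)
open import Algebra.Properties.Semiring.Sum +-*-semiring using (sum; sum-cong-≗; sum-remove; sum-replicate-zero; ∑-distrib-+; ∑-comm; *-distribˡ-sum)
open import Data.List.Base using (List; []; _∷_; [_]; allFin; map; concatMap; cartesianProduct)
open import Data.List.Membership.Propositional.Properties using (∈-allFin)
open import Data.List.Relation.Unary.All as All using ([]; _∷_)
open import Data.List.Relation.Unary.Any as Any using (Any; here)
import Data.List.Relation.Unary.All.Properties as All
import Data.List.Relation.Unary.Any.Properties as Any
open import Data.Nat.Base as ℕ using (ℕ; zero; suc; _^_)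
open import Data.Product.Base using (∃; ∃₂; _×_; _,_; proj₁; proj₂; uncurry)
open import Data.Sum.Base as Sum using (_⊎_; inj₁; inj₂)
open import Data.Vec.Base using ([]; _∷_; lookup; insertAt; removeAt)
open import Data.Vec.Functional.Properties using (lookup-++ˡ; lookup-++ʳ)
open import Data.Vec.Properties using (≡-dec; ∷-injective; lookup-map; map-insertAt; insertAt-lookup; insertAt-punchIn; removeAt-insertAt; insertAt-removeAt; []=⇒lookup; lookup⇒[]=)
open import Function.Base using (_∘_)
open import Function.Bundles using (Bijection; _⇔_; mk⇔)
open import Function.Definitions using (StrictlySurjective)
open import Level using (0ℓ)
open import Relation.Binary.Bundles using (Setoid)
open import Relation.Binary.Definitions using (Decidable; tri<; tri≈; tri>)
open import Relation.Binary.PropositionalEquality using (_≡_; _≢_; refl; sym; trans; cong; cong₂; subst; ≢-sym; setoid; module ≡-Reasoning)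
open import Relation.Nullary.Decidable using (Dec; yes; no; does; _×-dec_; _⊎-dec_; _→-dec_; does-⇔; dec-true; dec-false)
open import Relation.Nullary.Negation using (¬_; contradiction)

open Partition using (A; B; cover; disjoint)

private
  variable
    n : ℕ

-- Partitions as complementary pairs of subsets.

∁-involutive : (X : Subset n) → ∁ (∁ X) ≡ X
∁-involutive []      = refl
∁-involutive (x ∷ X) = cong₂ _∷_ (not-involutive x) (∁-involutive X)

X∩∁X≡⊥ : (X : Subset n) → X ∩ ∁ X ≡ ⊥
X∩∁X≡⊥ []          = refl
X∩∁X≡⊥ (true  ∷ X) = cong (false ∷_) (X∩∁X≡⊥ X)
X∩∁X≡⊥ (false ∷ X) = cong (false ∷_) (X∩∁X≡⊥ X)

-- At each coordinate, covering and disjointness leave one value for `Y` once `X` is known. Hence a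
-- partition is determined by its part `A`, and equality in `Π` becomes equality of the parts `A` up
-- to complement.
∁-unique : (X Y : Subset n) → X ∪ Y ≡ ⊤ → X ∩ Y ≡ ⊥ → Y ≡ ∁ X
∁-unique []      []      _ _ = refl
∁-unique (x ∷ X) (y ∷ Y) p q =
  let (p₀ , p₁) = ∷-injective p ; (q₀ , q₁) = ∷-injective q
  in cong₂ _∷_ (side x y p₀ q₀) (∁-unique X Y p₁ q₁)
  where
  side : ∀ x y → x ∨ y ≡ true → x ∧ y ≡ false → y ≡ not x
  side true  false _ _ = refl
  side false true  _ _ = refl

B≡∁A : (p : Partition n) → B p ≡ ∁ (A p)
B≡∁A p = ∁-unique (A p) (B p) (cover p) (disjoint p)

fromSubset : Subset n → Partition n
fromSubset X = X ∣ ∁ X ⟨ p∪∁p≡⊤ X , X∩∁X≡⊥ X ⟩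

A≡A⇒≈ₚ : (p q : Partition n) → A p ≡ A q → p ≈ₚ q
A≡A⇒≈ₚ p q eq = inj₁ (eq , trans (B≡∁A p) (trans (cong ∁ eq) (sym (B≡∁A q))))

A≡∁A⇒≈ₚ : (p q : Partition n) → A p ≡ ∁ (A q) → p ≈ₚ q
A≡∁A⇒≈ₚ p q eq = inj₂
  ( trans eq (sym (B≡∁A q))
  , trans (B≡∁A p) (trans (cong ∁ eq) (∁-involutive (A q))) )

≈ₚ⇒A≡A⊎A≡∁A : (p q : Partition n) → p ≈ₚ q → A p ≡ A q ⊎ A p ≡ ∁ (A q)
≈ₚ⇒A≡A⊎A≡∁A p q (inj₁ (eq , _)) = inj₁ eq
≈ₚ⇒A≡A⊎A≡∁A p q (inj₂ (eq , _)) = inj₂ (trans eq (B≡∁A q))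

≈ₚ-sym : (p q : Partition n) → p ≈ₚ q → q ≈ₚ p
≈ₚ-sym p q = Setoid.sym (Π _) {p} {q}

≈ₚ-trans : (p q r : Partition n) → p ≈ₚ q → q ≈ₚ r → p ≈ₚ r
≈ₚ-trans p q r = Setoid.trans (Π _) {p} {q} {r}

infix 4 _≈ₚ?_
_≈ₚ?_ : Decidable (_≈ₚ_ {n})
p ≈ₚ? q = (A p ≟ˢ A q ×-dec B p ≟ˢ B q) ⊎-dec (A p ≟ˢ B q ×-dec B p ≟ˢ A q)
  where _≟ˢ_ = ≡-dec _≟ᵇ_

Separates-resp-≈ₚ : (p q : Partition n) → p ≈ₚ q → ∀ {i j} → Separates p i j → Separates q i j
Separates-resp-≈ₚ (_ ∣ _ ⟨ _ , _ ⟩) (_ ∣ _ ⟨ _ , _ ⟩) (inj₁ (refl , refl)) s = s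
Separates-resp-≈ₚ (_ ∣ _ ⟨ _ , _ ⟩) (_ ∣ _ ⟨ _ , _ ⟩) (inj₂ (refl , refl)) s = Sum.swap s

Separates-sym : (p : Partition n) → ∀ {i j} → Separates p i j → Separates p j i
Separates-sym p (inj₁ (a , b)) = inj₂ (b , a)
Separates-sym p (inj₂ (a , b)) = inj₁ (b , a)

-- Since `B` carries the negated bits of `A`, feasibility amounts to one equation between two bits
-- of `A`.
Feasible⇒same-side : ∀ {v k} (p : Partition n) → Feasible v k p → lookup (A p) v ≡ lookup (A p) k
Feasible⇒same-side         p (inj₁ (v∈A , k∈A)) = trans ([]=⇒lookup v∈A) (sym ([]=⇒lookup k∈A))
Feasible⇒same-side {v = v} {k} p (inj₂ (v∈B , k∈B)) = trans (outside v v∈B) (sym (outside k k∈B))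
  where
  outside : ∀ i → i ∈ B p → lookup (A p) i ≡ false
  outside i i∈B = begin
    lookup (A p) i             ≡⟨ not-involutive _ ⟨
    not (not (lookup (A p) i)) ≡⟨ cong not (lookup-map i not (A p)) ⟨
    not (lookup (∁ (A p)) i)   ≡⟨ cong (λ X → not (lookup X i)) (B≡∁A p) ⟨
    not (lookup (B p) i)       ≡⟨ cong not ([]=⇒lookup i∈B) ⟩
    false                      ∎
    where open ≡-Reasoning

same-side⇒Feasible : ∀ {v k} (p : Partition n) → lookup (A p) v ≡ lookup (A p) k → Feasible v k p
same-side⇒Feasible {v = v} {k} p eq with lookup (A p) v in eqᵥ
... | true  = inj₁ (lookup⇒[]= v _ eqᵥ , lookup⇒[]= k _ (sym eq))
... | false = inj₂ (member v eqᵥ , member k (sym eq))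
  where
  member : ∀ i → lookup (A p) i ≡ false → i ∈ B p
  member i out = lookup⇒[]= i _
    (trans (cong (λ X → lookup X i) (B≡∁A p)) (trans (lookup-map i not (A p)) (cong not out)))

-- Extending a partition by the vertex `k`.

xor-cancelʳ : ∀ s t x → s xor x ≡ t xor x → s ≡ t
xor-cancelʳ false false _     _ = refl
xor-cancelʳ true  true  _     _ = refl
xor-cancelʳ false true  false ()
xor-cancelʳ false true  true  ()
xor-cancelʳ true  false false ()
xor-cancelʳ true  false true  ()

module _ {v k : Fin (suc n)} (v≢k : v ≢ k) where

  private
    v′ : Fin n
    v′ = punchOut (≢-sym v≢k)

  -- k is put on the side of v if s is false, and on the opposite side otherwise.
  extendSet : Bool → Subset n → Subset (suc n)
  extendSet s X = insertAt X k (s xor lookup X v′)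

  extend : Bool → Partition n → Partition (suc n)
  extend s p = fromSubset (extendSet s (A p))

  feasible-extension≈extend : ∀ p → feasible-extension v≢k p ≈ₚ extend false p
  feasible-extension≈extend p = A≡A⇒≈ₚ (feasible-extension v≢k p) (extend false p) refl

  -- Negation moves out of the second argument of `xor`. This makes `extend` respect the exchange of
  -- the two parts.
  extendSet-∁ : ∀ s X → extendSet s (∁ X) ≡ ∁ (extendSet s X)
  extendSet-∁ s X = begin
    insertAt (∁ X) k (s xor lookup (∁ X) v′)   ≡⟨ cong (λ x → insertAt (∁ X) k (s xor x)) (lookup-map v′ not X) ⟩
    insertAt (∁ X) k (s xor not (lookup X v′)) ≡⟨ cong (insertAt (∁ X) k) (not-distribʳ-xor s _) ⟨
    insertAt (∁ X) k (not (s xor lookup X v′)) ≡⟨ map-insertAt not _ X k ⟨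
    ∁ (extendSet s X)                          ∎
    where open ≡-Reasoning

  -- Deleting coordinate `k` recovers the subset; the entry at `k` then recovers the bit by
  -- cancelling the known side of `v`.
  extendSet-injective : ∀ s t X Y → extendSet s X ≡ extendSet t Y → s ≡ t × X ≡ Y
  extendSet-injective s t X Y eq = xor-cancelʳ s t (lookup X v′) side , X≡Y
    where
    open ≡-Reasoning
    X≡Y : X ≡ Y
    X≡Y = trans (sym (removeAt-insertAt X k _)) (trans (cong (λ Z → removeAt Z k) eq) (removeAt-insertAt Y k _))
    side : s xor lookup X v′ ≡ t xor lookup X v′
    side = begin
      s xor lookup X v′         ≡⟨ insertAt-lookup X k _ ⟨
      lookup (extendSet s X) k  ≡⟨ cong (λ Z → lookup Z k) eq ⟩
      lookup (extendSet t Y) k  ≡⟨ insertAt-lookup Y k _ ⟩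
      t xor lookup Y v′         ≡⟨ cong (λ Z → t xor lookup Z v′) X≡Y ⟨
      t xor lookup X v′         ∎

  extend-cong : ∀ s p q → p ≈ₚ q → extend s p ≈ₚ extend s q
  extend-cong s p q p≈q with ≈ₚ⇒A≡A⊎A≡∁A p q p≈q
  ... | inj₁ eq = A≡A⇒≈ₚ (extend s p) (extend s q) (cong (extendSet s) eq)
  ... | inj₂ eq = A≡∁A⇒≈ₚ (extend s p) (extend s q) (trans (cong (extendSet s) eq) (extendSet-∁ s (A q)))

  extend-injective : ∀ s t p q → extend s p ≈ₚ extend t q → s ≡ t × p ≈ₚ q
  extend-injective s t p q eq with ≈ₚ⇒A≡A⊎A≡∁A (extend s p) (extend t q) eq
  ... | inj₁ eq′ = let (s≡t , X≡Y) = extendSet-injective s t (A p) (A q) eq′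
                   in s≡t , A≡A⇒≈ₚ p q X≡Y
  ... | inj₂ eq′ = let (s≡t , X≡Y) = extendSet-injective s t (A p) (∁ (A q)) (trans eq′ (sym (extendSet-∁ t (A q))))
                   in s≡t , A≡∁A⇒≈ₚ p q X≡Y

  feasible-extension-injective : ∀ p q → feasible-extension v≢k p ≈ₚ feasible-extension v≢k q → p ≈ₚ q
  feasible-extension-injective p q eq = proj₂ (extend-injective false false p q
    (≈ₚ-trans (extend false p) (feasible-extension v≢k p) (extend false q)
      (≈ₚ-sym (feasible-extension v≢k p) (extend false p) (feasible-extension≈extend p))
      (≈ₚ-trans (feasible-extension v≢k p) (feasible-extension v≢k q) (extend false q) eq (feasible-extension≈extend q))))

  feasible-extension-cong : ∀ p q → p ≈ₚ q → feasible-extension v≢k p ≈ₚ feasible-extension v≢k q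
  feasible-extension-cong p q (inj₁ (refl , refl)) = inj₁ (refl , refl)
  feasible-extension-cong p q (inj₂ (refl , refl)) = inj₂ (refl , refl)

  extend-surjective : ∀ q → ∃₂ λ s p → extend s p ≈ₚ q
  -- The bit `x xor y` records whether `k` and `v` lie on opposite sides in `q`; the second `xor`
  -- with `y` restores the entry `x` at `k`.
  extend-surjective q = x xor y , fromSubset X , A≡A⇒≈ₚ (extend (x xor y) (fromSubset X)) q (begin
    insertAt X k ((x xor y) xor y) ≡⟨ cong (insertAt X k) (xor-assoc x y y) ⟩
    insertAt X k (x xor (y xor y)) ≡⟨ cong (λ z → insertAt X k (x xor z)) (xor-same y) ⟩
    insertAt X k (x xor false)     ≡⟨ cong (insertAt X k) (xor-identityʳ x) ⟩
    insertAt X k x                 ≡⟨ insertAt-removeAt (A q) k ⟩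
    A q                            ∎)
    where
    open ≡-Reasoning
    X = removeAt (A q) k
    x = lookup (A q) k
    y = lookup X v′

  lookup-insertAt-contract : ∀ (X : Subset n) u → lookup (insertAt X k (lookup X v′)) u ≡ lookup X (contract v≢k u)
  lookup-insertAt-contract X u with k ≟ u
  ... | yes refl = insertAt-lookup X k _
  ... | no  k≢u  = trans (cong (lookup (insertAt X k (lookup X v′))) (sym (punchIn-punchOut k≢u)))
                         (insertAt-punchIn X k _ (punchOut k≢u))

  lookup-extendSet-v : ∀ s X → lookup (extendSet s X) v ≡ lookup X v′
  lookup-extendSet-v s X = trans (cong (lookup (extendSet s X)) (sym (punchIn-punchOut (≢-sym v≢k))))
                                 (insertAt-punchIn X k _ v′)

  extend-false-feasible : ∀ p → Feasible v k (extend false p)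
  extend-false-feasible p = same-side⇒Feasible (extend false p)
    (trans (lookup-extendSet-v false (A p)) (sym (insertAt-lookup (A p) k _)))

  extend-true-infeasible : ∀ p → ¬ Feasible v k (extend true p)
  extend-true-infeasible p f = x≢notx (lookup (A p) v′)
    (trans (sym (lookup-extendSet-v true (A p)))
      (trans (Feasible⇒same-side (extend true p) f) (insertAt-lookup (A p) k _)))
    where
    x≢notx : ∀ x → x ≢ not x
    x≢notx false ()
    x≢notx true  ()

  -- Each part of the feasible extension is the preimage of a part of `p` under contraction, because
  -- `k` is contracted to `v` and gets the side of `v`.
  Separates-feasible-extension : ∀ p {i j} →
    Separates (feasible-extension v≢k p) i j ⇔ Separates p (contract v≢k i) (contract v≢k j)
  Separates-feasible-extension p = mk⇔
    (Sum.map (λ (a , b) → down (A p) a , down (B p) b) (λ (a , b) → down (B p) a , down (A p) b))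
    (Sum.map (λ (a , b) → up (A p) a , up (B p) b) (λ (a , b) → up (B p) a , up (A p) b))
    where
    down : ∀ (X : Subset n) {i} → i ∈ insertAt X k (lookup X v′) → contract v≢k i ∈ X
    down X {i} i∈ = lookup⇒[]= _ X (trans (sym (lookup-insertAt-contract X i)) ([]=⇒lookup i∈))
    up : ∀ (X : Subset n) {i} → contract v≢k i ∈ X → i ∈ insertAt X k (lookup X v′)
    up X {i} i∈ = lookup⇒[]= i _ (trans (lookup-insertAt-contract X i) ([]=⇒lookup i∈))

Feasible-resp-≈ₚ : ∀ {v k} (p q : Partition n) → p ≈ₚ q → Feasible v k p → Feasible v k q
Feasible-resp-≈ₚ (_ ∣ _ ⟨ _ , _ ⟩) (_ ∣ _ ⟨ _ , _ ⟩) (inj₁ (refl , refl)) f = f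
Feasible-resp-≈ₚ (_ ∣ _ ⟨ _ , _ ⟩) (_ ∣ _ ⟨ _ , _ ⟩) (inj₂ (refl , refl)) f = Sum.swap f

-- Orders of the columns.

module _ {m} {v k : Fin (suc (suc m))} (v≢k : v ≢ k) (ord′ : ColumnOrder m) where

  private
    side : Fin 2 → Bool
    side zero    = false
    side (suc _) = true

    side-injective : ∀ s t → side s ≡ side t → s ≡ t
    side-injective zero       zero       _ = refl
    side-injective (suc zero) (suc zero) _ = refl

    side-surjective : ∀ b → ∃ λ s → side s ≡ b
    side-surjective false = zero , refl
    side-surjective true  = suc zero , refl

    -- An index below `2 * 2 ^ m` is a block and a position in it: block 0 lists the feasible
    -- extensions in the order `ord′`, block 1 the extensions with `k` opposite to `v`.
    to′ : Fin 2 × Fin (2 ^ m) → Partition (suc (suc m))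
    to′ (s , j) = extend v≢k (side s) (column ord′ j)

    to : Fin (2 ^ suc m) → Partition (suc (suc m))
    to i = to′ (remQuot (2 ^ m) i)

    to-combine : ∀ s j → to (combine s j) ≡ to′ (s , j)
    to-combine s j = cong to′ (remQuot-combine s j)

    to-injective : ∀ {i j} → to i ≈ₚ to j → i ≡ j
    to-injective {i} {j} eq =
      let (s , x) = remQuot {2} (2 ^ m) i ; (t , y) = remQuot {2} (2 ^ m) j
          (s≡t , x≈y) = extend-injective v≢k (side s) (side t) (column ord′ x) (column ord′ y) eq
      in trans (sym (combine-remQuot {2} (2 ^ m) i))
           (trans (cong₂ combine (side-injective s t s≡t) (Bijection.injective ord′ x≈y))
                  (combine-remQuot {2} (2 ^ m) j))

    to-surjective : ∀ q → ∃ λ i → to i ≈ₚ q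
    to-surjective q =
      let (b , p , ext≈q) = extend-surjective v≢k q
          (s , s≡b)       = side-surjective b
          (j , ordj≈p)    = Bijection.strictlySurjective ord′ p
      in combine s j ,
         subst (_≈ₚ q) (sym (trans (to-combine s j) (cong (λ b → extend v≢k b (column ord′ j)) s≡b)))
           (≈ₚ-trans (extend v≢k b (column ord′ j)) (extend v≢k b p) q
             (extend-cong v≢k b (column ord′ j) p ordj≈p) ext≈q)

  feasibleFirstOrder : ColumnOrder (suc m)
  feasibleFirstOrder = record
    { to        = to
    ; cong      = λ { refl → inj₁ (refl , refl) }
    ; bijective = to-injective , λ q → let (i , eq) = to-surjective q in i , λ { refl → eq }
    }

  feasibleFirstOrder-feasibleFirst : FeasibleFirst v≢k ord′ feasibleFirstOrder
  feasibleFirstOrder-feasibleFirst = record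
    { feasible     = λ i → subst (Feasible v k) (sym (to-combine zero i)) (extend-false-feasible v≢k (column ord′ i))
    ; non-feasible = infeasible
    ; aligned      = λ j → subst (_≈ₚ feasible-extension v≢k (column ord′ j)) (sym (to-combine zero j))
        (≈ₚ-sym (feasible-extension v≢k (column ord′ j)) (extend v≢k false (column ord′ j)) (feasible-extension≈extend v≢k (column ord′ j)))
    }
    where
    infeasible : ∀ i → ¬ Feasible v k (to (2 ^ m ↑ʳ i))
    -- The bound `2 ^ m + 0` is `1 * 2 ^ m`, so `i` is a position in the single block that remains
    -- after block 0.
    infeasible i f with combine-surjective {1} {2 ^ m} i
    ... | zero , j , refl = extend-true-infeasible v≢k (column ord′ j) (subst (Feasible v k) (to-combine (suc zero) j) f)

-- Built by doubling from the single partition of one vertex, with the vertices 0 and 1 as the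
-- distinct pair. It shows that orders exist and is the starting point for enumerating them.
columnOrder : ∀ n → ColumnOrder n
columnOrder zero    = record
  { to        = λ _ → fromSubset (true ∷ [])
  ; cong      = λ _ → inj₁ (refl , refl)
  ; bijective = (λ { {zero} {zero} _ → refl }) , λ q → zero , λ _ → one q (A q) refl
  }
  where
  one : ∀ q X → A q ≡ X → fromSubset (true ∷ []) ≈ₚ q
  one q (true  ∷ []) eq = A≡A⇒≈ₚ (fromSubset (true ∷ [])) q (sym eq)
  one q (false ∷ []) eq = A≡∁A⇒≈ₚ (fromSubset (true ∷ [])) q (sym (cong ∁ eq))
columnOrder (suc n) = feasibleFirstOrder {v = zero} {suc zero} (λ ()) (columnOrder n)

-- Finite sums and double sums.

sum-zero : {f : Fin n → ℤ} → (∀ i → f i ≡ 0ℤ) → sum f ≡ 0ℤ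
sum-zero {n = n} f≡0 = trans (sum-cong-≗ f≡0) (sum-replicate-zero n)

sum-single : (f : Fin n → ℤ) (z : Fin n) → (∀ i → i ≢ z → f i ≡ 0ℤ) → sum f ≡ f z
sum-single {n = suc n} f z f≡0 = begin
  sum f                            ≡⟨ sum-remove {i = z} f ⟩
  f z + sum (λ i → f (punchIn z i)) ≡⟨ cong (f z +_) (sum-zero (λ i → f≡0 _ (punchInᵢ≢i z i))) ⟩
  f z + 0ℤ                         ≡⟨ +-identityʳ _ ⟩
  f z                              ∎
  where open ≡-Reasoning

sum-split : ∀ m {n} (f : Fin (m ℕ.+ n) → ℤ) → sum f ≡ sum (λ i → f (i ↑ˡ n)) + sum (λ i → f (m ↑ʳ i))
sum-split zero    f = sym (+-identityˡ _)
sum-split (suc m) f = trans (cong (λ z → f zero + z) (sum-split m (f ∘ suc))) (sym (+-assoc (f zero) _ _))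

sum² : (Fin n → Fin n → ℤ) → ℤ
sum² F = sum λ i → sum λ j → F i j

sum²-cong : {F G : Fin n → Fin n → ℤ} → (∀ i j → F i j ≡ G i j) → sum² F ≡ sum² G
sum²-cong F≡G = sum-cong-≗ λ i → sum-cong-≗ (F≡G i)

sum²-distrib-+ : (F G : Fin n → Fin n → ℤ) → sum² (λ i j → F i j + G i j) ≡ sum² F + sum² G
sum²-distrib-+ F G = trans (sum-cong-≗ λ i → ∑-distrib-+ (F i) (G i)) (∑-distrib-+ (λ i → sum (F i)) (λ i → sum (G i)))

upper : (Fin n → Fin n → ℤ) → Fin n → Fin n → ℤ
upper F i j with i <? j
... | yes _ = F i j
... | no  _ = 0ℤ

upper-cong : {F G : Fin n → Fin n → ℤ} → (∀ i j → F i j ≡ G i j) → ∀ i j → upper F i j ≡ upper G i j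
upper-cong F≡G i j with i <? j
... | yes _ = F≡G i j
... | no  _ = refl

module _ (F : Fin n → Fin n → ℤ) (F-sym : ∀ i j → F i j ≡ F j i) (F-diag : ∀ i → F i i ≡ 0ℤ) where

  -- By trichotomy exactly one of the two terms survives off the diagonal; on the diagonal both
  -- vanish, as does `F`.
  upper+upperᵀ : ∀ i j → upper F i j + upper F j i ≡ F i j
  upper+upperᵀ i j with i <? j | j <? i
  ... | yes i<j | yes j<i = contradiction j<i (<-asym i<j)
  ... | yes _   | no _    = +-identityʳ _
  ... | no _    | yes _   = trans (+-identityˡ _) (F-sym j i)
  ... | no i≮j  | no j≮i  with <-cmp i j
  ...   | tri< i<j _ _  = contradiction i<j i≮j
  ...   | tri≈ _ refl _ = sym (F-diag i)
  ...   | tri> _ _ j<i  = contradiction j<i j≮i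

  sum²-upper-double : sum² (upper F) + sum² (upper F) ≡ sum² F
  sum²-upper-double = begin
    sum² (upper F) + sum² (upper F)               ≡⟨ cong (sum² (upper F) +_) (∑-comm (upper F)) ⟩
    sum² (upper F) + sum² (λ i j → upper F j i)   ≡⟨ sum²-distrib-+ (upper F) _ ⟨
    sum² (λ i j → upper F i j + upper F j i)      ≡⟨ sum²-cong upper+upperᵀ ⟩
    sum² F                                        ∎
    where open ≡-Reasoning

double-injective : ∀ x y → x + x ≡ y + y → x ≡ y
double-injective x y eq = *-cancelˡ-≡ (1ℤ + 1ℤ) x y (trans (twice x) (trans eq (sym (twice y))))
  where
  twice : ∀ z → (1ℤ + 1ℤ) * z ≡ z + z
  twice z = trans (*-distribʳ-+ z 1ℤ 1ℤ) (cong₂ _+_ (*-identityˡ z) (*-identityˡ z))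

-- Double sums under contraction.

contract-k : {v k : Fin (suc n)} (v≢k : v ≢ k) → contract v≢k k ≡ punchOut (≢-sym v≢k)
contract-k {k = k} v≢k with k ≟ k
... | yes _  = refl
... | no k≢k = contradiction refl k≢k

infix 5 [_]·_
[_]·_ : {P : Set} → Dec P → ℤ → ℤ
[ d ]· z = if does d then z else 0ℤ

sum-[≡]· : (z : Fin n) (f : Fin n → ℤ) → sum (λ i → [ i ≟ z ]· f i) ≡ f z
sum-[≡]· z f = trans
  (sum-single _ z λ i i≢z → cong (λ b → if b then f i else 0ℤ) (dec-false (i ≟ z) i≢z))
  (cong (λ b → if b then f z else 0ℤ) (dec-true (z ≟ z) refl))

module _ {v k : Fin (suc n)} (v≢k : v ≢ k) where

  private
    v′ : Fin n
    v′ = punchOut (≢-sym v≢k)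

  -- The sum of F over the pairs which contract to (i , j), except (k , k).
  foldEntries : (Fin (suc n) → Fin (suc n) → ℤ) → Fin n → Fin n → ℤ
  foldEntries F i j =
    F (punchIn k i) (punchIn k j) + (([ i ≟ v′ ]· F k (punchIn k j)) + ([ j ≟ v′ ]· F (punchIn k i) k))

  -- Splitting off row `k` and column `k` leaves a corner, which is 0, and two lines. The indicators
  -- put these lines back at row and column `v′`, each entry once.
  sum²-foldEntries : ∀ F → F k k ≡ 0ℤ → sum² F ≡ sum² (foldEntries F)
  sum²-foldEntries F Fkk≡0 = begin
    sum² F
      ≡⟨ sum-remove {i = k} (λ u → sum (F u)) ⟩
    sum (F k) + sum (λ i → sum (F (punchIn k i)))
      ≡⟨ cong₂ _+_ row-k (trans (sum-cong-≗ λ i → sum-remove {i = k} (F (punchIn k i))) (∑-distrib-+ (λ i → F (punchIn k i) k) _)) ⟩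
    r + (q + s)
      ≡⟨ trans (sym (+-assoc r q s)) (+-comm (r + q) s) ⟩
    s + (r + q)
      ≡⟨ cong (s +_) (cong₂ _+_ rows columns) ⟨
    s + (sum² (λ i j → [ i ≟ v′ ]· F k (punchIn k j)) + sum² (λ i j → [ j ≟ v′ ]· F (punchIn k i) k))
      ≡⟨ cong (s +_) (sum²-distrib-+ (λ i j → [ i ≟ v′ ]· F k (punchIn k j)) _) ⟨
    s + sum² (λ i j → ([ i ≟ v′ ]· F k (punchIn k j)) + ([ j ≟ v′ ]· F (punchIn k i) k))
      ≡⟨ sum²-distrib-+ (λ i j → F (punchIn k i) (punchIn k j)) _ ⟨
    sum² (foldEntries F)
      ∎
    where
    open ≡-Reasoning
    r = sum λ j → F k (punchIn k j)
    q = sum λ i → F (punchIn k i) k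
    s = sum² λ i j → F (punchIn k i) (punchIn k j)
    row-k : sum (F k) ≡ r
    row-k = trans (sum-remove {i = k} (F k)) (trans (cong (_+ r) Fkk≡0) (+-identityˡ r))
    rows : sum² (λ i j → [ i ≟ v′ ]· F k (punchIn k j)) ≡ r
    rows = trans (∑-comm {n} {n} _) (sum-cong-≗ λ j → sum-[≡]· v′ (λ _ → F k (punchIn k j)))
    columns : sum² (λ i j → [ j ≟ v′ ]· F (punchIn k i) k) ≡ q
    columns = sum-cong-≗ λ i → sum-[≡]· v′ (λ _ → F (punchIn k i) k)

  -- Every entry occurring in the fold lies over `(i , j)`, so a comparison on that fibre suffices,
  -- and the additive `h` passes through the sum. It serves with the zero map over non-edges and
  -- with the truncation by a fixed condition over edges.
  foldEntries-hom : ∀ F K (h : ℤ → ℤ) → h 0ℤ ≡ 0ℤ → (∀ x y → h (x + y) ≡ h x + h y) → ∀ i j →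
    (∀ u w → contract v≢k u ≡ i → contract v≢k w ≡ j → F u w ≡ h (K u w)) →
    foldEntries F i j ≡ h (foldEntries K i j)
  foldEntries-hom F K h h-0 h-+ i j F≡hK = begin
    foldEntries F i j
      ≡⟨ cong₂ _+_ (F≡hK _ _ ci cj) (cong₂ _+_ first second) ⟩
    h x + (h y + h z)
      ≡⟨ cong (h x +_) (h-+ y z) ⟨
    h x + h (y + z)
      ≡⟨ h-+ x (y + z) ⟨
    h (foldEntries K i j)
      ∎
    where
    open ≡-Reasoning
    x = K (punchIn k i) (punchIn k j)
    y = [ i ≟ v′ ]· K k (punchIn k j)
    z = [ j ≟ v′ ]· K (punchIn k i) k
    ci = contract-punchIn v≢k i
    cj = contract-punchIn v≢k j
    first : [ i ≟ v′ ]· F k (punchIn k j) ≡ h ([ i ≟ v′ ]· K k (punchIn k j))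
    first with i ≟ v′
    ... | yes i≡v′ = F≡hK _ _ (trans (contract-k v≢k) (sym i≡v′)) cj
    ... | no  _    = sym h-0
    second : [ j ≟ v′ ]· F (punchIn k i) k ≡ h ([ j ≟ v′ ]· K (punchIn k i) k)
    second with j ≟ v′
    ... | yes j≡v′ = F≡hK _ _ ci (trans (contract-k v≢k) (sym j≡v′))
    ... | no  _    = sym h-0

-- Sums over the edges of a graph.

module _ (g : Graph n) where
  open Graph g

  entry : (∀ {i j} → Adj i j → ℤ) → Fin n → Fin n → ℤ
  entry f i j with adj? i j
  ... | yes e = f e
  ... | no  _ = 0ℤ

  edge-sum : (∀ {i j} → Adj i j → ℤ) → ℤ
  edge-sum f = sum² (upper (entry f))

  entry-edge : (f : ∀ {i j} → Adj i j → ℤ) → ∀ {i j} → (∀ (e e′ : Adj i j) → f e ≡ f e′) → ∀ e → entry f i j ≡ f e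
  entry-edge f {i} {j} f-irr e with adj? i j
  ... | yes e′ = f-irr e′ e
  ... | no ¬e  = contradiction e ¬e

  entry-non-edge : ∀ (f : ∀ {i j} → Adj i j → ℤ) {i j} → ¬ Adj i j → entry f i j ≡ 0ℤ
  entry-non-edge f {i} {j} ¬e with adj? i j
  ... | yes e = contradiction e ¬e
  ... | no  _ = refl

  edge-sum-cong : {f f′ : ∀ {i j} → Adj i j → ℤ} → (∀ {i j} (e : Adj i j) → f e ≡ f′ e) → edge-sum f ≡ edge-sum f′
  edge-sum-cong {f} {f′} f≡f′ = sum²-cong (upper-cong pointwise)
    where
    pointwise : ∀ i j → entry f i j ≡ entry f′ i j
    pointwise i j with adj? i j
    ... | yes e = f≡f′ e
    ... | no  _ = refl

  -- The sum over labels is moved inside both vertex sums. Away from the pairs `i < j` that are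
  -- edges, both sides are 0 because each product has a zero factor.
  edge-sum-linear : ∀ {a} (c : Fin a → ℤ) (f : Fin a → ∀ {i j} → Adj i j → ℤ) →
    sum (λ x → c x * edge-sum (f x)) ≡ edge-sum (λ e → sum λ x → c x * f x e)
  edge-sum-linear c f = begin
    sum (λ x → c x * edge-sum (f x))
      ≡⟨ sum-cong-≗ (λ x → trans (*-distribˡ-sum (c x) (λ i → sum (t x i))) (sum-cong-≗ λ i → *-distribˡ-sum (c x) (t x i))) ⟩
    sum (λ x → sum λ i → sum λ j → c x * t x i j)
      ≡⟨ ∑-comm (λ x i → sum λ j → c x * t x i j) ⟩
    sum (λ i → sum λ x → sum λ j → c x * t x i j)
      ≡⟨ sum-cong-≗ (λ i → ∑-comm (λ x j → c x * t x i j)) ⟩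
    sum (λ i → sum λ j → sum λ x → c x * t x i j)
      ≡⟨ sum²-cong pointwise ⟩
    edge-sum (λ e → sum λ x → c x * f x e)
      ∎
    where
    open ≡-Reasoning
    t = λ x → upper (entry (f x))
    pointwise : ∀ i j → sum (λ x → c x * t x i j) ≡ upper (entry (λ e → sum λ x → c x * f x e)) i j
    pointwise i j with i <? j
    ... | no  _ = sum-zero (*-zeroʳ ∘ c)
    ... | yes _ with adj? i j
    ...   | yes _ = refl
    ...   | no  _ = sum-zero (*-zeroʳ ∘ c)

  -- The table `entry f` is symmetric because `f` is, and its diagonal vanishes because there are no
  -- loops.
  edge-sum-double : (f : ∀ {i j} → Adj i j → ℤ) → (∀ {i j} (e : Adj i j) (e′ : Adj j i) → f e ≡ f e′) →
    edge-sum f + edge-sum f ≡ sum² (entry f)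
  edge-sum-double f f-sym = sum²-upper-double (entry f) entry-sym (λ _ → entry-non-edge f irrefl)
    where
    entry-sym : ∀ i j → entry f i j ≡ entry f j i
    entry-sym i j with adj? i j | adj? j i
    ... | yes e | yes e′ = f-sym e e′
    ... | yes e | no ¬e′ = contradiction (symm e) ¬e′
    ... | no ¬e | yes e′ = contradiction (symm e′) ¬e
    ... | no _  | no _   = refl

-- Exponents of the toric map as edge sums.

separated unseparated : Partition n → Fin n → Fin n → Bool
separated   p i j = does (separates? p i j)
unseparated p i j = not (separated p i j)

module _ {a} (H : LabelledGraph n a) where
  open LabelledGraph H

  ∑ₑ≡edge-sum : (f : ∀ {i j} → Adj i j → ℤ) → ∑ₑ f ≡ edge-sum graph f
  ∑ₑ≡edge-sum f = sum²-cong pointwise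
    where
    pointwise : ∀ i j → edge-term f i j ≡ upper (entry graph f) i j
    pointwise i j with i <? j
    ... | no  _ = refl
    ... | yes _ with adj? i j
    ...   | yes _ = refl
    ...   | no  _ = refl

  -- The Boolean table `b` is kept general so that one argument covers both exponents: `separated p`
  -- gives those of the `s` variables and `unseparated p` those of the `t` variables.
  weight : (Fin n → Fin n → Bool) → Fin a → ∀ {i j} → Adj i j → ℤ
  weight b x {i} {j} e = if b i j ∧ does (l e ≟ x) then σ e else 0ℤ

  weight-sym : ∀ b x → (∀ i j → b i j ≡ b j i) → ∀ {i j} (e : Adj i j) (e′ : Adj j i) → weight b x e ≡ weight b x e′
  weight-sym b x b-sym {i} {j} e e′ =
    cong₂ (λ c s → if c then s else 0ℤ) (cong₂ (λ c y → c ∧ does (y ≟ x)) (b-sym i j) (l-sym e e′)) (σ-sym e e′)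

  -- On `×-dec`, `does` computes to a Boolean conjunction, so the summands already agree and only
  -- the form of the sum changes.
  exponent-s≡ : ∀ p x → exponent-s p x ≡ edge-sum graph (weight (separated p) x)
  exponent-s≡ p x = ∑ₑ≡edge-sum _

  exponent-t≡ : ∀ p x → exponent-t p x ≡ edge-sum graph (weight (unseparated p) x)
  exponent-t≡ p x = ∑ₑ≡edge-sum _

separated-sym : (p : Partition n) → ∀ i j → separated p i j ≡ separated p j i
separated-sym p i j = does-⇔ (mk⇔ (Separates-sym p) (Separates-sym p)) (separates? p i j) (separates? p j i)

toric-cong : ∀ {n n′ a} (H : LabelledGraph n a) (H′ : LabelledGraph n′ a) p p′ →
  let module H = LabelledGraph H ; module H′ = LabelledGraph H′ in
  (∀ x → H.exponent-s p x ≡ H′.exponent-s p′ x) → (∀ x → H.exponent-t p x ≡ H′.exponent-t p′ x) →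
  ∀ z → H.toric p z ≡ H′.toric p′ z
toric-cong {a = a} H H′ _ _ s≡ t≡ z with splitAt a z
... | inj₁ x = s≡ x
... | inj₂ x = t≡ x

module _ {a} (H : LabelledGraph n a) where
  open LabelledGraph H

  weight-cong : ∀ {b b′ : Fin n → Fin n → Bool} x → (∀ i j → b i j ≡ b′ i j) →
    edge-sum graph (weight H b x) ≡ edge-sum graph (weight H b′ x)
  weight-cong x b≡b′ = edge-sum-cong graph λ {i} {j} e → cong (λ c → if c ∧ does (l e ≟ x) then σ e else 0ℤ) (b≡b′ i j)

  -- The exponents depend on the partition only through `Separates`, which is symmetric in the two
  -- parts.
  toric-resp-≈ₚ : ∀ p q → p ≈ₚ q → ∀ z → toric p z ≡ toric q z
  toric-resp-≈ₚ p q p≈q = toric-cong H H p q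
    (λ x → trans (exponent-s≡ H p x) (trans (weight-cong x same) (sym (exponent-s≡ H q x))))
    (λ x → trans (exponent-t≡ H p x) (trans (weight-cong x λ i j → cong not (same i j)) (sym (exponent-t≡ H q x))))
    where
    same : ∀ i j → separated p i j ≡ separated q i j
    same i j = does-⇔ (mk⇔ (Separates-resp-≈ₚ p q p≈q) (Separates-resp-≈ₚ q p (≈ₚ-sym p q p≈q)))
                      (separates? p i j) (separates? q i j)

-- Multiplication by the relabelling matrix.

module _ {a a′} (G : LabelledGraph n a) (cls : Fin a → Fin a′) (sur : StrictlySurjective _≡_ cls) where
  open LabelledGraph G

  private
    Gl′ = relabel G cls sur

  -- An edge labelled `z` contributes only at `x = z`, where the entry of the block tests whether
  -- the class of `z` is `y`.
  relabelling-block-weight : ∀ (b : Bool) z s y →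
    sum (λ x → relabelling-block cls y x * (if b ∧ does (z ≟ x) then s else 0ℤ)) ≡ (if b ∧ does (cls z ≟ y) then s else 0ℤ)
  relabelling-block-weight b z s y = begin
    sum (λ x → relabelling-block cls y x * (if b ∧ does (z ≟ x) then s else 0ℤ))
      ≡⟨ sum-single _ z (λ x x≢z → trans (cong (relabelling-block cls y x *_)
           (cong (λ d → if d then s else 0ℤ) (trans (cong (b ∧_) (dec-false (z ≟ x) (x≢z ∘ sym))) (∧-zeroʳ b)))) (*-zeroʳ (relabelling-block cls y x))) ⟩
    relabelling-block cls y z * (if b ∧ does (z ≟ z) then s else 0ℤ)
      ≡⟨ cong₂ (λ d d′ → (if d then 1ℤ else 0ℤ) * (if b ∧ d′ then s else 0ℤ))
           (does-⇔ (mk⇔ sym sym) (y ≟ cls z) (cls z ≟ y)) (dec-true (z ≟ z) refl) ⟩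
    (if does (cls z ≟ y) then 1ℤ else 0ℤ) * (if b ∧ true then s else 0ℤ)
      ≡⟨ indicator b (does (cls z ≟ y)) ⟩
    (if b ∧ does (cls z ≟ y) then s else 0ℤ)
      ∎
    where
    open ≡-Reasoning
    indicator : ∀ b d → (if d then 1ℤ else 0ℤ) * (if b ∧ true then s else 0ℤ) ≡ (if b ∧ d then s else 0ℤ)
    indicator true  true  = *-identityˡ s
    indicator true  false = *-zeroˡ s
    indicator false d     = *-zeroʳ (if d then 1ℤ else 0ℤ)

  relabelling-block-edge-sum : ∀ b y →
    sum (λ x → relabelling-block cls y x * edge-sum graph (weight G b x)) ≡ edge-sum graph (weight Gl′ b y)
  relabelling-block-edge-sum b y = trans
    (edge-sum-linear graph (relabelling-block cls y) (weight G b))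
    (edge-sum-cong graph λ {i} {j} e → relabelling-block-weight (b i j) (l e) (σ e) y)

  -- The matrix is block diagonal: in each row the sum splits at `a`, the zero block kills one half,
  -- and the other half relabels the exponents of the same kind.
  relabelling-matrix-toric : ∀ p i →
    sum (λ z → relabelling-matrix cls i z * toric p z) ≡ LabelledGraph.toric Gl′ p i
  relabelling-matrix-toric p i with splitAt a′ i
  ... | inj₁ y = begin
    sum (λ z → beside Bl 𝟘 y z * toric p z)
      ≡⟨ sum-split a _ ⟩
    sum (λ x → beside Bl 𝟘 y (x ↑ˡ a) * toric p (x ↑ˡ a)) + sum (λ x → beside Bl 𝟘 y (a ↑ʳ x) * toric p (a ↑ʳ x))
      ≡⟨ cong₂ _+_
           (sum-cong-≗ λ x → cong₂ _*_ (lookup-++ˡ (Bl y) (𝟘 {a′} {a} y) x)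
                                       (trans (lookup-++ˡ (exponent-s p) (exponent-t p) x) (exponent-s≡ G p x)))
           (sum-zero λ x → trans (cong (_* toric p (a ↑ʳ x)) (lookup-++ʳ (Bl y) (𝟘 {a′} {a} y) x)) (*-zeroˡ (toric p (a ↑ʳ x)))) ⟩
    sum (λ x → Bl y x * edge-sum graph (weight G (separated p) x)) + 0ℤ
      ≡⟨ +-identityʳ _ ⟩
    sum (λ x → Bl y x * edge-sum graph (weight G (separated p) x))
      ≡⟨ relabelling-block-edge-sum (separated p) y ⟩
    edge-sum graph (weight Gl′ (separated p) y)
      ≡⟨ exponent-s≡ Gl′ p y ⟨
    LabelledGraph.exponent-s Gl′ p y
      ∎
    where
    open ≡-Reasoning
    Bl = relabelling-block cls
  ... | inj₂ y = begin
    sum (λ z → beside 𝟘 Bl y z * toric p z)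
      ≡⟨ sum-split a _ ⟩
    sum (λ x → beside 𝟘 Bl y (x ↑ˡ a) * toric p (x ↑ˡ a)) + sum (λ x → beside 𝟘 Bl y (a ↑ʳ x) * toric p (a ↑ʳ x))
      ≡⟨ cong₂ _+_
           (sum-zero λ x → trans (cong (_* toric p (x ↑ˡ a)) (lookup-++ˡ (𝟘 {a′} {a} y) (Bl y) x)) (*-zeroˡ (toric p (x ↑ˡ a))))
           (sum-cong-≗ λ x → cong₂ _*_ (lookup-++ʳ (𝟘 {a′} {a} y) (Bl y) x)
                                       (trans (lookup-++ʳ (exponent-s p) (exponent-t p) x) (exponent-t≡ G p x))) ⟩
    0ℤ + sum (λ x → Bl y x * edge-sum graph (weight G (unseparated p) x))
      ≡⟨ +-identityˡ _ ⟩
    sum (λ x → Bl y x * edge-sum graph (weight G (unseparated p) x))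
      ≡⟨ relabelling-block-edge-sum (unseparated p) y ⟩
    edge-sum graph (weight Gl′ (unseparated p) y)
      ≡⟨ exponent-t≡ Gl′ p y ⟨
    LabelledGraph.exponent-t Gl′ p y
      ∎
    where
    open ≡-Reasoning
    Bl = relabelling-block cls

-- Exponents of the collapsed graph.

module _ {n a a′} (G : LabelledGraph (suc n) a) (v₁ k : Fin (suc n)) (v₁≢k : v₁ ≢ k)
         (v₁≁k : ¬ LabelledGraph.Adj G v₁ k) (cls : Fin a → Fin a′)
         (q : IsQuotient (CollapsingLabels G v₁ k) cls) (nz : Collapse.NonzeroMultiplicity G v₁ k v₁≢k) where

  open Collapse G v₁ k v₁≢k using (c; v₁′; Adj′; σ′; σ₀-sym; collapsedGraph)

  private
    module G = LabelledGraph G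
    Gl′ = relabel G cls (IsQuotient.surjective q)
    G/  = Collapse.collapse G v₁ k v₁≢k v₁≁k q nz
    module G/ = LabelledGraph G/

  -- An edge with one end at `v₁′` receives the entries from `v₁` and from `k`, where `σ₀` is 0 if
  -- the edge is missing. With no end there both indicators vanish, and two ends there would form a
  -- loop.
  σ′≡foldEntries : ∀ {i j} → Adj′ i j → σ′ i j ≡ foldEntries v₁≢k G.σ₀ i j
  σ′≡foldEntries {i} {j} e with i ≟ v₁′ | j ≟ v₁′
  ... | yes i≡ | yes j≡ = contradiction (subst (Adj′ i) (trans j≡ (sym i≡)) e) G/.irrefl
  ... | yes i≡ | no  _  = cong₂ _+_
    (cong (λ u → G.σ₀ u (punchIn k j)) (sym (trans (cong (punchIn k) i≡) (punchIn-punchOut (≢-sym v₁≢k)))))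
    (sym (+-identityʳ _))
  ... | no  _  | yes j≡ = cong₂ _+_
    (trans (σ₀-sym v₁ (punchIn k i))
           (cong (G.σ₀ (punchIn k i)) (sym (trans (cong (punchIn k) j≡) (punchIn-punchOut (≢-sym v₁≢k))))))
    (trans (σ₀-sym k (punchIn k i)) (sym (+-identityˡ _)))
  ... | no  _  | no  _  = sym (+-identityʳ _)

  module _ (b : Fin n → Fin n → Bool) (b-sym : ∀ i j → b i j ≡ b j i) (x : Fin a′) where

    private
      bᶜ : Fin (suc n) → Fin (suc n) → Bool
      bᶜ u w = b (c u) (c w)

      F : Fin (suc n) → Fin (suc n) → ℤ
      F = entry G.graph (weight Gl′ bᶜ x)

    entry-collapse : ∀ i j → entry G/.graph (weight G/ b x) i j ≡ foldEntries v₁≢k F i j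
    entry-collapse i j = by-cases (G/.adj? i j)
      where
      open ≡-Reasoning
      by-cases : Dec (Adj′ i j) → entry G/.graph (weight G/ b x) i j ≡ foldEntries v₁≢k F i j
      -- No pair over a non-edge is an edge of `G`, so the fold is the image of itself under the
      -- zero map.
      by-cases (no ¬e) = trans (entry-non-edge G/.graph (weight G/ b x) ¬e) (sym
        (foldEntries-hom v₁≢k F F (λ _ → 0ℤ) refl (λ _ _ → refl) i j
          λ u w cu≡i cw≡j → entry-non-edge G.graph (weight Gl′ bᶜ x) λ e → ¬e (u , w , e , cu≡i , cw≡j)))
      by-cases (yes e) = begin
        entry G/.graph (weight G/ b x) i j
          ≡⟨ entry-edge G/.graph (weight G/ b x) irr e ⟩
        h (σ′ i j)
          ≡⟨ cong h (σ′≡foldEntries e) ⟩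
        h (foldEntries v₁≢k G.σ₀ i j)
          ≡⟨ foldEntries-hom v₁≢k F G.σ₀ h (h-0 cond) (h-+ cond) i j F≡hσ₀ ⟨
        foldEntries v₁≢k F i j
          ∎
        where
        -- All edges of `G` over `(i , j)` share this condition, so it factors out as the additive
        -- map `h` and only the multiplicities are summed.
        cond = b i j ∧ does (G/.l e ≟ x)
        h : ℤ → ℤ
        h z = if cond then z else 0ℤ
        h-0 : ∀ c → (if c then 0ℤ else 0ℤ) ≡ 0ℤ
        h-0 true  = refl
        h-0 false = refl
        h-+ : ∀ c y z → (if c then y + z else 0ℤ) ≡ (if c then y else 0ℤ) + (if c then z else 0ℤ)
        h-+ true  _ _ = refl
        h-+ false _ _ = refl
        irr : ∀ e e′ → weight G/ b x e ≡ weight G/ b x e′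
        irr e e′ = cong (λ y → if b i j ∧ does (y ≟ x) then σ′ i j else 0ℤ) (G/.l-irr e e′)
        F≡hσ₀ : ∀ u w → c u ≡ i → c w ≡ j → F u w ≡ h (G.σ₀ u w)
        F≡hσ₀ u w cu≡i cw≡j with G.adj? u w
        -- The edge `e′` itself witnesses adjacency of `i` and `j`, with label `cls (l e′)`; that
        -- labels do not depend on the witness identifies it with the label of `e`.
        ... | yes e′ = cong₂ (λ d y → if d ∧ does (y ≟ x) then G.σ e′ else 0ℤ)
                         (cong₂ b cu≡i cw≡j) (G/.l-irr (u , w , e′ , cu≡i , cw≡j) e)
        ... | no  _  = sym (h-0 cond)

    edge-sum-collapse : edge-sum G.graph (weight Gl′ bᶜ x) ≡ edge-sum G/.graph (weight G/ b x)
    edge-sum-collapse = double-injective _ _ (begin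
      edge-sum G.graph (weight Gl′ bᶜ x) + edge-sum G.graph (weight Gl′ bᶜ x)
        ≡⟨ edge-sum-double G.graph (weight Gl′ bᶜ x) (weight-sym Gl′ bᶜ x λ u w → b-sym (c u) (c w)) ⟩
      sum² F
        ≡⟨ sum²-foldEntries v₁≢k F (entry-non-edge G.graph (weight Gl′ bᶜ x) G.irrefl) ⟩
      sum² (foldEntries v₁≢k F)
        ≡⟨ sum²-cong entry-collapse ⟨
      sum² (entry G/.graph (weight G/ b x))
        ≡⟨ edge-sum-double G/.graph (weight G/ b x) (weight-sym G/ b x b-sym) ⟨
      edge-sum G/.graph (weight G/ b x) + edge-sum G/.graph (weight G/ b x)
        ∎)
      where open ≡-Reasoning

  toric-collapse : ∀ p z → LabelledGraph.toric Gl′ (feasible-extension v₁≢k p) z ≡ G/.toric p z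
  toric-collapse p = toric-cong Gl′ G/ pᶠ p
    (λ x → trans (exponent-s≡ Gl′ pᶠ x) (trans (weight-cong Gl′ x same)
      (trans (edge-sum-collapse (separated p) (separated-sym p) x) (sym (exponent-s≡ G/ p x)))))
    (λ x → trans (exponent-t≡ Gl′ pᶠ x) (trans (weight-cong Gl′ x λ u w → cong not (same u w))
      (trans (edge-sum-collapse (unseparated p) (λ i j → cong not (separated-sym p i j)) x) (sym (exponent-t≡ G/ p x)))))
    where
    pᶠ = feasible-extension v₁≢k p
    same : ∀ u w → separated pᶠ u w ≡ separated p (c u) (c w)
    same u w = does-⇔ (Separates-feasible-extension v₁≢k p) (separates? pᶠ u w) (separates? p (c u) (c w))

-- The matrix of the collapse.

module _ {m} {v k : Fin (suc (suc m))} (v≢k : v ≢ k) where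

  private
    _ᶠ : Partition (suc m) → Partition (suc (suc m))
    _ᶠ = feasible-extension v≢k

  collapseMatrix : ColumnOrder (suc m) → ColumnOrder m → Matrix (2 ^ suc m) (2 ^ m)
  collapseMatrix ord ord′ r j = [ column ord r ≈ₚ? (column ord′ j ᶠ) ]· 1ℤ

  -- In the first block, alignment makes the partition of row `r` the extension of the `i′`-th one,
  -- and injectivity leaves `j = i′` as the only match. In the second block it is not feasible,
  -- whereas every extension is.
  collapseMatrix-block : ∀ ord ord′ {ordᶠ} → FeasibleFirst v≢k ord′ ordᶠ →
    ∀ r i → column ord r ≈ₚ column ordᶠ i → ∀ j → collapseMatrix ord ord′ r j ≡ collapse-block m i j
  collapseMatrix-block ord ord′ {ordᶠ} ff r i r≈i j with splitAt (2 ^ m) i in eq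
  ... | inj₁ i′ = cong (λ d → if d then 1ℤ else 0ℤ) (does-⇔ (mk⇔ to from) (column ord r ≈ₚ? (column ord′ j ᶠ)) (i′ ≟ j))
    where
    open FeasibleFirst ff
    r≈i′ : column ord r ≈ₚ (column ord′ i′ ᶠ)
    r≈i′ = ≈ₚ-trans (column ord r) (column ordᶠ i) (column ord′ i′ ᶠ) r≈i
      (subst (λ z → column ordᶠ z ≈ₚ (column ord′ i′ ᶠ)) (splitAt⁻¹-↑ˡ eq) (aligned i′))
    to : column ord r ≈ₚ (column ord′ j ᶠ) → i′ ≡ j
    to r≈j = Bijection.injective ord′ (feasible-extension-injective v≢k (column ord′ i′) (column ord′ j)
      (≈ₚ-trans (column ord′ i′ ᶠ) (column ord r) (column ord′ j ᶠ) (≈ₚ-sym (column ord r) (column ord′ i′ ᶠ) r≈i′) r≈j))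
    from : i′ ≡ j → column ord r ≈ₚ (column ord′ j ᶠ)
    from refl = r≈i′
  ... | inj₂ i′ = cong (λ d → if d then 1ℤ else 0ℤ) (dec-false (column ord r ≈ₚ? (column ord′ j ᶠ)) λ r≈j →
    non-feasible i′ (subst (λ z → Feasible v k (column ordᶠ z)) (sym (splitAt⁻¹-↑ʳ eq))
      (Feasible-resp-≈ₚ (column ord r) (column ordᶠ i) r≈i
        (Feasible-resp-≈ₚ (column ord′ j ᶠ) (column ord r) (≈ₚ-sym (column ord r) (column ord′ j ᶠ) r≈j)
          (Feasible-resp-≈ₚ (extend v≢k false (column ord′ j)) (column ord′ j ᶠ)
            (≈ₚ-sym (column ord′ j ᶠ) (extend v≢k false (column ord′ j)) (feasible-extension≈extend v≢k (column ord′ j)))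
            (extend-false-feasible v≢k (column ord′ j)))))))
    where open FeasibleFirst ff

  collapseMatrix-isCollapseMatrix : ∀ ord ord′ → IsCollapseMatrix v≢k ord ord′ (collapseMatrix ord ord′)
  collapseMatrix-isCollapseMatrix ord ord′ =
    feasibleFirstOrder v≢k ord′ , ff , collapseMatrix-block ord ord′ ff
    where ff = feasibleFirstOrder-feasibleFirst v≢k ord′

  -- Every row of `C` occurs at some position of `ordᶠ`, and there the block form prescribes its
  -- entries.
  collapseMatrix-unique : ∀ ord ord′ C → IsCollapseMatrix v≢k ord ord′ C → C ≋ collapseMatrix ord ord′
  collapseMatrix-unique ord ord′ C (ordᶠ , ff , C≡) r j =
    let (i , i≈r) = Bijection.strictlySurjective ordᶠ (column ord r)
        r≈i       = ≈ₚ-sym (column ordᶠ i) (column ord r) i≈r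
    in trans (C≡ r i r≈i j) (sym (collapseMatrix-block ord ord′ ff r i r≈i j))

  -- The entries only test `≈ₚ`. This matters for finiteness, since an enumerated order matches a
  -- given one only up to exchanging the parts of its columns.
  collapseMatrix-cong : ∀ ord ord₁ ord′ ord′₁ →
    (∀ r → column ord r ≈ₚ column ord₁ r) → (∀ j → column ord′ j ≈ₚ column ord′₁ j) →
    collapseMatrix ord ord′ ≋ collapseMatrix ord₁ ord′₁
  collapseMatrix-cong ord ord₁ ord′ ord′₁ r≈ j≈ r j = cong (λ d → if d then 1ℤ else 0ℤ)
    (does-⇔ (mk⇔ (λ eq → ≈ₚ-trans p₁ p q₁ (≈ₚ-sym p p₁ (r≈ r)) (≈ₚ-trans p q q₁ eq q≈q₁))
                 (λ eq → ≈ₚ-trans p p₁ q (r≈ r) (≈ₚ-trans p₁ q₁ q eq (≈ₚ-sym q q₁ q≈q₁))))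
            (p ≈ₚ? q) (p₁ ≈ₚ? q₁))
    where
    p = column ord r
    p₁ = column ord₁ r
    q = column ord′ j ᶠ
    q₁ = column ord′₁ j ᶠ
    q≈q₁ = feasible-extension-cong v≢k (column ord′ j) (column ord′₁ j) (j≈ j)

  -- By injectivity of `ord`, column `j` of the collapse matrix has its only 1 in row `r`.
  ⊗-collapseMatrix : ∀ {o} (M : Matrix o (2 ^ suc m)) ord ord′ i j r → column ord r ≈ₚ (column ord′ j ᶠ) →
    (M ⊗ collapseMatrix ord ord′) i j ≡ M i r
  ⊗-collapseMatrix M ord ord′ i j r r≈j = begin
    (M ⊗ collapseMatrix ord ord′) i j
      ≡⟨ sum-single _ r (λ s s≢r → trans
           (cong (λ d → M i s * (if d then 1ℤ else 0ℤ)) (dec-false (column ord s ≈ₚ? q) λ s≈j → s≢r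
             (Bijection.injective ord (≈ₚ-trans (column ord s) q (column ord r) s≈j (≈ₚ-sym (column ord r) q r≈j)))))
           (*-zeroʳ (M i s))) ⟩
    M i r * collapseMatrix ord ord′ r j
      ≡⟨ cong (λ d → M i r * (if d then 1ℤ else 0ℤ)) (dec-true (column ord r ≈ₚ? q) r≈j) ⟩
    M i r * 1ℤ
      ≡⟨ *-identityʳ (M i r) ⟩
    M i r
      ∎
    where
    open ≡-Reasoning
    q = column ord′ j ᶠ

-- Enumeration of the column orders.

-- Every bijection onto S is the given one preceded by a permutation of Fin N,
-- and the maps Fin N → Fin N are enumerated by Fin (N ^ N).
module _ {N} (S : Setoid 0ℓ 0ℓ) (β : Bijection (setoid (Fin N)) S) where

  private
    module S = Setoid S
    module β = Bijection β

    IsPermutation : (Fin N → Fin N) → Set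
    IsPermutation f = (∀ i j → f i ≡ f j → i ≡ j) × (∀ y → ∃ λ x → f x ≡ y)

    isPermutation? : ∀ f → Dec (IsPermutation f)
    isPermutation? f = all? (λ i → all? λ j → (f i ≟ f j) →-dec (i ≟ j)) ×-dec all? (λ y → any? λ x → f x ≟ y)

    reorder : ∀ f → IsPermutation f → Bijection (setoid (Fin N)) S
    reorder f (inj , sur) = record
      { to        = β.to ∘ f
      ; cong      = λ { refl → S.refl }
      ; bijective = (λ eq → inj _ _ (β.injective eq)) ,
                    λ y → let (x , fx≡) = sur (β.to⁻ y) in
                      x , λ { refl → S.trans (β.cong fx≡) (proj₂ (β.strictlySurjective y)) }
      }

    reorderings : ∀ f → Dec (IsPermutation f) → List (Bijection (setoid (Fin N)) S)
    reorderings f (yes π) = [ reorder f π ]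
    reorderings f (no  _) = []

  bijections : List (Bijection (setoid (Fin N)) S)
  bijections = concatMap (λ x → reorderings (finToFun x) (isPermutation? (finToFun x))) (allFin (N ^ N))

  bijections-complete : (γ : Bijection (setoid (Fin N)) S) → Any (λ δ → ∀ i → Bijection.to γ i S.≈ Bijection.to δ i) bijections
  bijections-complete γ =
    Any.concatMap⁺ _ (Any.map (λ { refl → found (isPermutation? f̂) }) (∈-allFin (funToFin f)))
    where
    module γ = Bijection γ
    f f̂ : Fin N → Fin N
    f i = β.to⁻ (γ.to i)
    -- The permutation sought is `γ` followed by the inverse of `β`. The list contains its decoded
    -- copy `f̂`, which agrees with `f` pointwise.
    f̂ = finToFun (funToFin f)
    β∘f̂≈γ : ∀ i → β.to (f̂ i) S.≈ γ.to i
    β∘f̂≈γ i = S.trans (β.cong (finToFun-funToFin f i)) (proj₂ (β.strictlySurjective (γ.to i)))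
    permutation : IsPermutation f̂
    permutation =
      (λ i j eq → γ.injective (S.trans (S.sym (β∘f̂≈γ i)) (S.trans (β.cong eq) (β∘f̂≈γ j)))) ,
      (λ y → let (x , γx≈) = γ.strictlySurjective (β.to y) in x , β.injective (S.trans (β∘f̂≈γ x) γx≈))
    found : ∀ d → Any (λ δ → ∀ i → γ.to i S.≈ Bijection.to δ i) (reorderings f̂ d)
    found (yes _) = here λ i → S.sym (β∘f̂≈γ i)
    found (no ¬π) = contradiction permutation ¬π

-- The product formula and the finiteness of the set of collapse matrices.

lemma4p3 :
    ∀ {m a a′ : ℕ} (G : LabelledGraph (suc (suc m)) a)
      (v₁ k : Fin (suc (suc m))) (v₁≢k : v₁ ≢ k)
      (v₁≁k : ¬ LabelledGraph.Adj G v₁ k)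
      (cls : Fin a → Fin a′) (q : IsQuotient (CollapsingLabels G v₁ k) cls)
      (nz : Collapse.NonzeroMultiplicity G v₁ k v₁≢k) →
    Collapse.Singular G v₁ k v₁≢k v₁≁k →
    let G/   = Collapse.collapse G v₁ k v₁≢k v₁≁k q nz
        Gl′  = relabel G cls (IsQuotient.surjective q)
        R    = relabelling-matrix cls
        IsC  = λ ord ord′ C → IsCollapseMatrix v₁≢k ord ord′ C × ((R ⊗ 𝒜 G ord) ⊗ C) ≋ 𝒜 G/ ord′
    in
      (∀ (ord : ColumnOrder (suc m)) → (R ⊗ 𝒜 G ord) ≋ 𝒜 Gl′ ord)
      × (∀ (ord : ColumnOrder (suc m)) (ord′ : ColumnOrder m) (C : Matrix (2 ^ suc m) (2 ^ m)) →
           IsCollapseMatrix v₁≢k ord ord′ C → ((R ⊗ 𝒜 G ord) ⊗ C) ≋ 𝒜 G/ ord′)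
      × (∀ (ord : ColumnOrder (suc m)) (ord′ : ColumnOrder m) → NonemptyFinite (λ C → IsC ord ord′ C))
      × NonemptyFinite (λ C → ∃₂ λ ord ord′ → IsC ord ord′ C)
lemma4p3 {m} G v₁ k v₁≢k v₁≁k cls q nz _ =
  relabels , collapses , each-order , all-orders
  where
  open ≡-Reasoning
  G/  = Collapse.collapse G v₁ k v₁≢k v₁≁k q nz
  Gl′ = relabel G cls (IsQuotient.surjective q)
  R   = relabelling-matrix cls

  relabels : ∀ ord → (R ⊗ 𝒜 G ord) ≋ 𝒜 Gl′ ord
  relabels ord i r = relabelling-matrix-toric G cls (IsQuotient.surjective q) (column ord r) i

  collapses : ∀ ord ord′ C → IsCollapseMatrix v₁≢k ord ord′ C → ((R ⊗ 𝒜 G ord) ⊗ C) ≋ 𝒜 G/ ord′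
  collapses ord ord′ C isC i j = begin
    ((R ⊗ 𝒜 G ord) ⊗ C) i j
      ≡⟨ sum-cong-≗ (λ s → cong ((R ⊗ 𝒜 G ord) i s *_) (collapseMatrix-unique v₁≢k ord ord′ C isC s j)) ⟩
    ((R ⊗ 𝒜 G ord) ⊗ collapseMatrix v₁≢k ord ord′) i j
      ≡⟨ ⊗-collapseMatrix v₁≢k (R ⊗ 𝒜 G ord) ord ord′ i j r r≈j ⟩
    (R ⊗ 𝒜 G ord) i r
      ≡⟨ relabels ord i r ⟩
    LabelledGraph.toric Gl′ (column ord r) i
      ≡⟨ toric-resp-≈ₚ Gl′ (column ord r) pᶠ r≈j i ⟩
    LabelledGraph.toric Gl′ pᶠ i
      ≡⟨ toric-collapse G v₁ k v₁≢k v₁≁k cls q nz (column ord′ j) i ⟩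
    𝒜 G/ ord′ i j
      ∎
    where
    pᶠ  = feasible-extension v₁≢k (column ord′ j)
    -- The position in `ord` of the feasible extension of the `j`-th column; multiplication by `C`
    -- selects it.
    r   = proj₁ (Bijection.strictlySurjective ord pᶠ)
    r≈j = proj₂ (Bijection.strictlySurjective ord pᶠ)

  IsC : ColumnOrder (suc m) → ColumnOrder m → Matrix (2 ^ suc m) (2 ^ m) → Set
  IsC ord ord′ C = IsCollapseMatrix v₁≢k ord ord′ C × ((R ⊗ 𝒜 G ord) ⊗ C) ≋ 𝒜 G/ ord′

  member : ∀ ord ord′ → IsC ord ord′ (collapseMatrix v₁≢k ord ord′)
  member ord ord′ = isC , collapses ord ord′ _ isC
    where isC = collapseMatrix-isCollapseMatrix v₁≢k ord ord′

  each-order : ∀ ord ord′ → NonemptyFinite (IsC ord ord′)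
  each-order ord ord′ =
    (C₀ , member ord ord′) , C₀ ∷ [] , member ord ord′ ∷ [] ,
    λ C (isC , _) → here (collapseMatrix-unique v₁≢k ord ord′ C isC)
    where C₀ = collapseMatrix v₁≢k ord ord′

  all-orders : NonemptyFinite (λ C → ∃₂ λ ord ord′ → IsC ord ord′ C)
  all-orders =
    (_ , columnOrder (suc m) , columnOrder m , member (columnOrder (suc m)) (columnOrder m)) ,
    map (uncurry (collapseMatrix v₁≢k)) (cartesianProduct ords ords′) ,
    All.map⁺ (All.universal (λ (ord , ord′) → ord , ord′ , member ord ord′) _) ,
    -- Both orders agree columnwise up to `≈ₚ` with enumerated ones, and the forced matrix does not
    -- change under such a replacement.
    λ C (ord , ord′ , isC , _) → Any.map⁺ (Any.map
      (λ {(ord₁ , ord′₁)} (r≈ , j≈) r j → trans (collapseMatrix-unique v₁≢k ord ord′ C isC r j)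
                                                (collapseMatrix-cong v₁≢k ord ord₁ ord′ ord′₁ r≈ j≈ r j))
      (Any.cartesianProduct⁺ (bijections-complete (Π _) (columnOrder (suc m)) ord) (bijections-complete (Π _) (columnOrder m) ord′)))
    where
    ords  = bijections (Π _) (columnOrder (suc m))
    ords′ = bijections (Π _) (columnOrder m)
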